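{- For all integers $s\ge 1$ and $p\ge 0$ the following identities of formal series hold (empty sums are $0$): 1. $(2s-1)!\,\mathrm{I}_{2s}^{2p}(q)=\sum_{r=1}^{p}t(2s,2r)\mathrm{D}^{2r-1}A_{2p-2r+1}(q^2)+\sum_{r=p+1}^{s}t(2s,2r)\mathrm{D}^{2p}A_{2r-2p-1}(q^2)$; 2. $(2s)!\,\mathrm{I}_{2s+1}^{2p+1}(q)=\sum_{r=0}^{p}2^{ -2r}t(2s+1,2r+1)\mathrm{D}^{2r}C_{2p-2r+1}(q)+\sum_{r=p+1}^{s}2^{ -2r}t(2s+1,2r+1)\mathrm{D}^{2p+1}F_{2r-2p-1}(q)$; 3. $(2s-1)!(-1)^{s-1}\mathrm{II}_{2s}^{2p}(q)=\sum_{r=1}^{p}t(2s,2r)\mathrm{D}^{2r-1}L_{2p-2r+1}(q^2)+\sum_{r=p+1}^{s}t(2s,2r)\mathrm{D}^{2p}B_{2r-2p-1}(q^2)$; 4. $(2s)!(-1)^s\mathrm{II}_{2s+1}^{2p}(q)=\sum_{r=0}^{p-1}2^{ -2r}t(2s+1,2r+1)\mathrm{D}^{2r}N_{2p-2r}(q)+\sum_{r=p}^{s}2^{ -2r}t(2s+1,2r+1)\mathrm{D}^{2p}G_{2r-2p}(q)$; 5. $(2s-1)!\,\mathrm{III}_{2s}^{2p}(q)=\sum_{r=1}^{p}t(2s,2r)\mathrm{D}^{2r-1}F_{2p-2r+1}(q)+\sum_{r=p+1}^{s}t(2s,2r)\mathrm{D}^{2p}C_{2r-2p-1}(q)$; 6.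 $(2s)!\,\mathrm{III}_{2s+1}^{2p+1}(q)=\sum_{r=0}^{p}t(2s+1,2r+1)\mathrm{D}^{2r}H_{2p-2r+1}(q)+\sum_{r=p+1}^{s}2^{2p+1-2r}t(2s+1,2r+1)\mathrm{D}^{2p+1}H_{2r-2p-1}(q)$; 7. $(2s-1)!(-1)^{s-1}\mathrm{IV}_{2s}^{2p}(q)=\sum_{r=1}^{p}t(2s,2r)\mathrm{D}^{2r-1}Q_{2p-2r+1}(q)+\sum_{r=p+1}^{s}t(2s,2r)\mathrm{D}^{2p}D_{2r-2p-1}(q)$; 8. $(2s)!(-1)^s\mathrm{IV}_{2s+1}^{2p}(q)=\sum_{r=0}^{p-1}t(2s+1,2r+1)\mathrm{D}^{2r}T_{2p-2r}(q)+\sum_{r=p}^{s}2^{2p-2r}t(2s+1,2r+1)\mathrm{D}^{2p}J_{2r-2p}(q)$; 9. $(2s-1)!\,\mathrm{V}_{2s}^{2p}(q)=\sum_{r=1}^{p}t(2s,2r)\mathrm{D}^{2r-1}B_{2p-2r+1}(q^2)+\sum_{r=p+1}^{s}t(2s,2r)\mathrm{D}^{2p}L_{2r-2p-1}(q^2)$; 10. $(2s)!\,\mathrm{V}_{2s+1}^{2p+1}(q)=\sum_{r=0}^{p}2^{ -2r}t(2s+1,2r+1)\mathrm{D}^{2r}D_{2p-2r+1}(q)+\sum_{r=p+1}^{s}2^{ -2r}t(2s+1,2r+1)\mathrm{D}^{2p+1}Q_{2r-2p-1}(q)$; 11. $(2s-1)!(-1)^{s-1}\mathrm{VI}_{2s}^{2p}(q)=\sum_{r=1}^{p}t(2s,2r)\mathrm{D}^{2r-1}M_{2p-2r+1}(q^2)+\sum_{r=p+1}^{s}t(2s,2r)\mathrm{D}^{2p}M_{2r-2p-1}(q^2)$;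 12. $(2s)!(-1)^s\mathrm{VI}_{2s+1}^{2p}(q)=\sum_{r=0}^{p-1}2^{ -2r}t(2s+1,2r+1)\mathrm{D}^{2r}P_{2p-2r}(q)+\sum_{r=p}^{s}2^{ -2r}t(2s+1,2r+1)\mathrm{D}^{2p}R_{2r-2p}(q)$; 13. $(2s-1)!\,\mathrm{VII}_{2s}^{2p+1}(q)=\sum_{r=1}^{p}t(2s,2r)\mathrm{D}^{2r-1}G_{2p-2r+2}(q)+\sum_{r=p+1}^{s}t(2s,2r)\mathrm{D}^{2p+1}N_{2r-2p-2}(q)$; 14. $(2s)!\,\mathrm{VII}_{2s+1}^{2p}(q)=\sum_{r=0}^{p-1}t(2s+1,2r+1)\mathrm{D}^{2r}J_{2p-2r}(q)+\sum_{r=p}^{s}2^{2p-2r}t(2s+1,2r+1)\mathrm{D}^{2p}T_{2r-2p}(q)$; 15. $(2s-1)!(-1)^{s-1}\mathrm{VIII}_{2s}^{2p+1}(q)=\sum_{r=1}^{p}t(2s,2r)\mathrm{D}^{2r-1}R_{2p-2r+2}(q)+\sum_{r=p+1}^{s}t(2s,2r)\mathrm{D}^{2p+1}P_{2r-2p-2}(q)$; 16. $(2s)!(-1)^s\mathrm{VIII}_{2s+1}^{2p+1}(q)=\sum_{r=0}^{p}t(2s+1,2r+1)\mathrm{D}^{2r}U_{2p-2r+1}(q)+\sum_{r=p+1}^{s}2^{2p-2r+1}t(2s+1,2r+1)\mathrm{D}^{2p+1}U_{2r-2p-1}(q)$.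
   Context: All series are formal series in $q^{1/2}$ (equivalently convergent for $0<|q|<1$ with a fixed choice of $q^{1/2}$). For integers $s\ge1$, $p\ge0$ (sums over $n\ge1$): $\mathrm{I}_s^p=\sum\frac{n^pq^{ns}}{(1-q^{2n})^s}$, $\mathrm{II}_s^p=\sum\frac{n^pq^{ns}}{(1+q^{2n})^s}$, $\mathrm{III}_s^p=\sum\frac{(2n-1)^pq^{(n-\frac12)s}}{(1-q^{2n-1})^s}$, $\mathrm{IV}_s^p=\sum\frac{(2n-1)^pq^{(n-\frac12)s}}{(1+q^{2n-1})^s}$, $\mathrm{V}_s^p=\sum\frac{(-1)^{n-1}n^pq^{ns}}{(1-q^{2n})^s}$, $\mathrm{VI}_s^p=\sum\frac{(-1)^{n-1}n^pq^{ns}}{(1+q^{2n})^s}$, $\mathrm{VII}_s^p=\sum\frac{(-1)^{n-1}(2n-1)^pq^{(n-\frac12)s}}{(1-q^{2n-1})^s}$, $\mathrm{VIII}_s^p=\sum\frac{(-1)^{n-1}(2n-1)^pq^{(n-\frac12)s}}{(1+q^{2n-1})^s}$. For integers $s\ge0$ (sums over $n\ge1$): $A_s=\sum\frac{n^sq^n}{1-q^n}$, $B_s=\sum\frac{(-1)^{n-1}n^sq^n}{1-q^n}$, $C_s=\sum\frac{n^sq^n}{1-q^{2n}}$, $D_s=\sum\frac{(-1)^{n-1}n^sq^n}{1-q^{2n}}$, $F_s=\sum\frac{(2n-1)^sq^{2n-1}}{1-q^{2n-1}}$, $G_s=\sum\frac{(-1)^{n-1}(2n-1)^sq^{2n-1}}{1-q^{2n-1}}$,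 $H_s=\sum\frac{(2n-1)^sq^{n-1/2}}{1-q^{2n-1}}$, $J_s=\sum\frac{(-1)^{n-1}(2n-1)^sq^{n-1/2}}{1-q^{2n-1}}$, $L_s=\sum\frac{n^sq^n}{1+q^n}$, $M_s=\sum\frac{(-1)^{n-1}n^sq^n}{1+q^n}$, $N_s=\sum\frac{n^sq^n}{1+q^{2n}}$, $P_s=\sum\frac{(-1)^{n-1}n^sq^n}{1+q^{2n}}$, $Q_s=\sum\frac{(2n-1)^sq^{2n-1}}{1+q^{2n-1}}$, $R_s=\sum\frac{(-1)^{n-1}(2n-1)^sq^{2n-1}}{1+q^{2n-1}}$, $T_s=\sum\frac{(2n-1)^sq^{n-1/2}}{1+q^{2n-1}}$, $U_s=\sum\frac{(-1)^{n-1}(2n-1)^sq^{n-1/2}}{1+q^{2n-1}}$. Central factorial numbers: for $n\ge1$, $x^2\prod_{k=1}^{n-1}(x^2-k^2)=\sum_{k=1}^n t(2n,2k)x^{2k}$; for $n\ge0$, $x\prod_{k=1}^n(x^2-\frac{(2k-1)^2}{4})=\sum_{k=0}^n t(2n+1,2k+1)x^{2k+1}$. The operator $\mathrm{D}$ acts on series $\sum_{\alpha\in\frac12\mathbb{Z}}a_\alpha q^\alpha$ by $\mathrm{D}\sum a_\alpha q^\alpha=\sum\alpha a_\alpha q^\alpha$ (i.e. $q\,d/dq$); $\mathrm{D}^0$ is the identity, and $\mathrm{D}^jF(q^2)$ denotes the series $\mathrm{D}^jF$ with $q$ replaced by $q^2$. -}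

module Defs where

open import Algebra.Bundles using (RawSemiring)
import Algebra.Definitions.RawSemiring as RawSemiringOps
open import Data.Bool.Base using (if_then_else_)
open import Data.Fin.Base using (toℕ)
open import Data.Integer.Base as ℤ using (ℤ; +_; -[1+_])
open import Data.Nat.Base using (ℕ; suc; _+_; _*_; _∸_; _^_; _≡ᵇ_)
open import Data.Nat.DivMod using () renaming (_/_ to _div_; _%_ to _mod_)
open import Data.Nat.GeneralisedArithmetic using (fold)
open import Data.Rational.Base as ℚ using (ℚ; 0ℚ; 1ℚ; ½)
open import Level using (0ℓ)
open import Relation.Binary.PropositionalEquality.Core using (_≡_)

module Opsℚ = RawSemiringOps ℚ.+-*-rawSemiring

fromℕ : ℕ → ℚ
fromℕ n = + n ℚ./ 1

-1^_ : ℕ → ℚ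
-1^ n = (ℚ.- 1ℚ) Opsℚ.^ n

2^_ : ℤ → ℚ
2^ (+ n)    = fromℕ 2 Opsℚ.^ n
2^ -[1+ n ] = ½ Opsℚ.^ suc n

-- Σ_{a ≤ i < b} f i, empty when b ≤ a.
∑ℚ : (a b : ℕ) → (ℕ → ℚ) → ℚ
∑ℚ a b f = Opsℚ.sum {b ∸ a} (λ i → f (a + toℕ i))

-- Formal power series over ℚ in one variable x, as coefficient functions.
-- For q-series the variable is x = q^{1/2}: f m is the coefficient of q^{m/2}.
Series : Set
Series = ℕ → ℚ

infix  4 _≈_
infixl 6 _⊕_ _⊖_
infixr 7 _·_
infixl 7 _⊛_ _⊘_
infixr 8 _⊛^_
infix  9 x^_ q^_ -1^_ 2^_ _⟨q²⟩

_≈_ : Series → Series → Set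
f ≈ g = ∀ m → f m ≡ g m

x^_ : ℕ → Series
(x^ k) m = if k ≡ᵇ m then 1ℚ else 0ℚ

𝟘 𝟙 : Series
𝟘 _ = 0ℚ
𝟙 = x^ 0

_⊕_ _⊖_ _⊛_ : Series → Series → Series
(f ⊕ g) m = f m ℚ.+ g m
(f ⊖ g) m = f m ℚ.- g m
(f ⊛ g) m = ∑ℚ 0 (suc m) (λ i → f i ℚ.* g (m ∸ i))

_·_ : ℚ → Series → Series
(c · f) m = c ℚ.* f m

seriesRawSemiring : RawSemiring 0ℓ 0ℓ
seriesRawSemiring = record
  { Carrier = Series ; _≈_ = _≈_ ; _+_ = _⊕_ ; _*_ = _⊛_ ; 0# = 𝟘 ; 1# = 𝟙 }

module OpsS = RawSemiringOps seriesRawSemiring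

_⊛^_ : Series → ℕ → Series
f ⊛^ n = f OpsS.^ n

-- Finite sums and products of series over a ≤ i < b.
∑< ∏< : (a b : ℕ) → (ℕ → Series) → Series
∑< a b F = OpsS.sum     {b ∸ a} (λ i → F (a + toℕ i))
∏< a b F = OpsS.product {b ∸ a} (λ i → F (a + toℕ i))

-- The infinite sum Σ_{n ≥ a} F n, for families in which F n is divisible
-- by x^n: only the terms with n ≤ m contribute to the coefficient of x^m.
-- Every use below is of this kind.
∑≥ : (a : ℕ) → (ℕ → Series) → Series
∑≥ a F m = ∑ℚ a (suc m) (λ n → F n m)

infixr 5 ∑< ∏< ∑≥
syntax ∑< a b (λ r → e) = ∑[ a ≤ r < b ] e
syntax ∏< a b (λ r → e) = ∏[ a ≤ r < b ] e
syntax ∑≥ a (λ n → e)   = ∑[ n ≥ a ] e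

-- 1/f = Σ_{k ≥ 0} (1 - f)^k, the multiplicative inverse of a series f with
-- constant term 1; all denominators below are of this form.
recip : Series → Series
recip f = ∑[ k ≥ 0 ] (𝟙 ⊖ f) ⊛^ k

_⊘_ : Series → Series → Series
f ⊘ g = f ⊛ recip g

-- q^ n is q^n, while x^ k is q^{k/2}; thus q^{n-1/2} = x^ (2 * n ∸ 1).
q^_ : ℕ → Series
q^ n = x^ (2 * n)

-- q d/dq
𝐃 : Series → Series
𝐃 f m = (+ m ℚ./ 2) ℚ.* f m

𝐃^ : ℕ → Series → Series
𝐃^ j f = fold f 𝐃 j

-- f(q²)
_⟨q²⟩ : Series → Series
(f ⟨q²⟩) m = if m mod 2 ≡ᵇ 0 then f (m div 2) else 0ℚ

-- Central factorial numbers, read off from their generating polynomials, so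
-- that they vanish outside the usual range of the second index:
-- tₑ n k = t(2n, 2k) for n ≥ 1, and tₒ n k = t(2n+1, 2k+1) for n ≥ 0.
tₑ tₒ : ℕ → ℕ → ℚ
tₑ n k = (x^ 2 ⊛ (∏[ 1 ≤ j < n ] (x^ 2 ⊖ fromℕ (j ^ 2) · 𝟙))) (2 * k)
tₒ n k = (x^ 1 ⊛ (∏[ 1 ≤ j < suc n ] (x^ 2 ⊖ (+ ((2 * j ∸ 1) ^ 2) ℚ./ 4) · 𝟙))) (2 * k + 1)

-- I s p is I_s^p, and so on.
I II III IV V VI VII VIII : (s p : ℕ) → Series
I    s p = ∑[ n ≥ 1 ] fromℕ (n ^ p) · (q^ (n * s) ⊘ (𝟙 ⊖ q^ (2 * n)) ⊛^ s)
II   s p = ∑[ n ≥ 1 ] fromℕ (n ^ p) · (q^ (n * s) ⊘ (𝟙 ⊕ q^ (2 * n)) ⊛^ s)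
III  s p = ∑[ n ≥ 1 ] fromℕ ((2 * n ∸ 1) ^ p) · (x^ ((2 * n ∸ 1) * s) ⊘ (𝟙 ⊖ q^ (2 * n ∸ 1)) ⊛^ s)
IV   s p = ∑[ n ≥ 1 ] fromℕ ((2 * n ∸ 1) ^ p) · (x^ ((2 * n ∸ 1) * s) ⊘ (𝟙 ⊕ q^ (2 * n ∸ 1)) ⊛^ s)
V    s p = ∑[ n ≥ 1 ] -1^ (n ∸ 1) · fromℕ (n ^ p) · (q^ (n * s) ⊘ (𝟙 ⊖ q^ (2 * n)) ⊛^ s)
VI   s p = ∑[ n ≥ 1 ] -1^ (n ∸ 1) · fromℕ (n ^ p) · (q^ (n * s) ⊘ (𝟙 ⊕ q^ (2 * n)) ⊛^ s)
VII  s p = ∑[ n ≥ 1 ] -1^ (n ∸ 1) · fromℕ ((2 * n ∸ 1) ^ p) · (x^ ((2 * n ∸ 1) * s) ⊘ (𝟙 ⊖ q^ (2 * n ∸ 1)) ⊛^ s)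
VIII s p = ∑[ n ≥ 1 ] -1^ (n ∸ 1) · fromℕ ((2 * n ∸ 1) ^ p) · (x^ ((2 * n ∸ 1) * s) ⊘ (𝟙 ⊕ q^ (2 * n ∸ 1)) ⊛^ s)

A B C D F G H J L M N P Q R T U : (s : ℕ) → Series
A s = ∑[ n ≥ 1 ] fromℕ (n ^ s) · (q^ n ⊘ (𝟙 ⊖ q^ n))
B s = ∑[ n ≥ 1 ] -1^ (n ∸ 1) · fromℕ (n ^ s) · (q^ n ⊘ (𝟙 ⊖ q^ n))
C s = ∑[ n ≥ 1 ] fromℕ (n ^ s) · (q^ n ⊘ (𝟙 ⊖ q^ (2 * n)))
D s = ∑[ n ≥ 1 ] -1^ (n ∸ 1) · fromℕ (n ^ s) · (q^ n ⊘ (𝟙 ⊖ q^ (2 * n)))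
F s = ∑[ n ≥ 1 ] fromℕ ((2 * n ∸ 1) ^ s) · (q^ (2 * n ∸ 1) ⊘ (𝟙 ⊖ q^ (2 * n ∸ 1)))
G s = ∑[ n ≥ 1 ] -1^ (n ∸ 1) · fromℕ ((2 * n ∸ 1) ^ s) · (q^ (2 * n ∸ 1) ⊘ (𝟙 ⊖ q^ (2 * n ∸ 1)))
H s = ∑[ n ≥ 1 ] fromℕ ((2 * n ∸ 1) ^ s) · (x^ (2 * n ∸ 1) ⊘ (𝟙 ⊖ q^ (2 * n ∸ 1)))
J s = ∑[ n ≥ 1 ] -1^ (n ∸ 1) · fromℕ ((2 * n ∸ 1) ^ s) · (x^ (2 * n ∸ 1) ⊘ (𝟙 ⊖ q^ (2 * n ∸ 1)))
L s = ∑[ n ≥ 1 ] fromℕ (n ^ s) · (q^ n ⊘ (𝟙 ⊕ q^ n))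
M s = ∑[ n ≥ 1 ] -1^ (n ∸ 1) · fromℕ (n ^ s) · (q^ n ⊘ (𝟙 ⊕ q^ n))
N s = ∑[ n ≥ 1 ] fromℕ (n ^ s) · (q^ n ⊘ (𝟙 ⊕ q^ (2 * n)))
P s = ∑[ n ≥ 1 ] -1^ (n ∸ 1) · fromℕ (n ^ s) · (q^ n ⊘ (𝟙 ⊕ q^ (2 * n)))
Q s = ∑[ n ≥ 1 ] fromℕ ((2 * n ∸ 1) ^ s) · (q^ (2 * n ∸ 1) ⊘ (𝟙 ⊕ q^ (2 * n ∸ 1)))
R s = ∑[ n ≥ 1 ] -1^ (n ∸ 1) · fromℕ ((2 * n ∸ 1) ^ s) · (q^ (2 * n ∸ 1) ⊘ (𝟙 ⊕ q^ (2 * n ∸ 1)))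
T s = ∑[ n ≥ 1 ] fromℕ ((2 * n ∸ 1) ^ s) · (x^ (2 * n ∸ 1) ⊘ (𝟙 ⊕ q^ (2 * n ∸ 1)))
U s = ∑[ n ≥ 1 ] -1^ (n ∸ 1) · fromℕ ((2 * n ∸ 1) ^ s) · (x^ (2 * n ∸ 1) ⊘ (𝟙 ⊕ q^ (2 * n ∸ 1)))

{-# OPTIONS --safe #-}

-- Put y = q^n or y = q^(n-1/2) and let δ = ±1 be the sign in 1 - δ y².  Then
--   (2s-1)! δ^(s-1) (y/(1 - δ y²))^(2s)   = Σ_{l≥1} δ^(l-1) Φ(l) y^(2l),     Φ(l) = l ∏_{j=1}^{s-1} (l² - j²),
--   (2s)!   δ^s     (y/(1 - δ y²))^(2s+1) = Σ_{l≥1} δ^(l-1) Ψ(l) y^(2l-1),   Ψ(l) = ∏_{j=1}^{s} ((l-1/2)² - (j-1/2)²),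
-- because multiplication by 1 - δ y² takes differences of the coefficients, and the differences of
-- Φ and Ψ are again multiples of Ψ and Φ.  Expanding Φ and Ψ by central factorial numbers turns every
-- left-hand side into a combination of double series Σ_{n,l} (signs) n^i l^j x^(u(n) v(l)).  Since 𝐃 multiplies
-- x^(u(n) v(l)) by a multiple of n l, such a series is a power of 𝐃 applied to one with i = 0 or j = 0;
-- in the case i = 0 the roles of n and l are exchanged.

module Submission where

open import Defs
open import Data.Nat.Base using (ℕ; _+_; _*_; _∸_; _≤_; _!)
open import Data.Integer.Base using (+_; -_; _-_)
open import Data.Product.Base using (_×_)
open import Algebra.Bundles using (CommutativeRing)
import Algebra.Properties.CommutativeSemiring.Exp as Exp
import Algebra.Properties.Semiring.Sum as Sum
open import Data.Bool.Base using (true; false)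
open import Data.Fin.Base using (toℕ)
import Data.Integer.Base as ℤ
import Data.Integer.Properties as ℤ
open import Data.Nat.Base using (zero; suc; _^_; _<_; z≤n; s≤s; s≤s⁻¹; _≡ᵇ_)
open import Data.Nat.Coprimality using (Coprime; 1-coprimeTo) renaming (sym to coprime-sym)
open import Data.Nat.DivMod using (m/n≡1+[m∸n]/n; m/n≤m) renaming (_/_ to _div_; _%_ to _mod_)
import Data.Nat.Properties as ℕ
open import Data.Product.Base using (_,_)
open import Data.Rational.Base as ℚ using (ℚ; 0ℚ; 1ℚ; ½; mkℚ) renaming (_+_ to _+ℚ_; _*_ to _*ℚ_; _-_ to _-ℚ_)
import Data.Rational.Properties as ℚ
open import Data.Rational.Solver using (module +-*-Solver)
open import Data.Sign.Base using (Sign) renaming (+ to pos; - to neg)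
open import Data.Sum.Base using (inj₁; inj₂)
open import Function.Base using (_∘_; id)
open import Relation.Binary.PropositionalEquality using (_≡_; refl; sym; trans; cong; cong₂; subst; subst₂; module ≡-Reasoning)
open +-*-Solver using (solve; _:+_; _:*_; _:-_; :-_; _:=_; con)
open Opsℚ using () renaming (_^_ to _^ℚ_)
open ≡-Reasoning

-- Behind `Φ` and `Ψ` are binomial coefficients: for δ = 1 the coefficient of y^(2l) in (y/(1 -
-- y²))^(2s) is C(l+s-1, 2s-1), and that of y^(2l-1) in the power 2s+1 is C(l+s-1, 2s). Multiplied
-- by the factorial they are products of consecutive factors placed symmetrically about l or l - ½,
-- hence odd in l or even in l - ½, which is the shape that central factorial numbers expand. The
-- split of the range of r compares exponents. The term of index r has n^i or (2n-1)^i, with i = 2p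
-- or 2p+1, beside l^(2r-1) or (l - ½)^(2r). Since 𝐃 raises both exponents at once, its power is the
-- smaller of them and the index of the Lambert series is their difference; ties fall into the
-- second sum. There n and l are exchanged, and with them the signs (-1)^(n-1) and δ^(l-1): this is
-- why `L` and `B` meet in one identity. Keeping both signs as parameters leaves seven identities to
-- prove. All powers of 2 come from `Ψ`, whose expansion is in (2l-1)/2, whereas 𝐃 multiplies its
-- terms by n(2l-1) or by (2n-1)(2l-1)/2.

private
  module ℚ-Sum = Sum (CommutativeRing.semiring ℚ.+-*-commutativeRing)
  module ℚ-Exp = Exp (CommutativeRing.commutativeSemiring ℚ.+-*-commutativeRing)

-- Finite sums of rationals

∑₀ : ℕ → (ℕ → ℚ) → ℚ
∑₀ = ∑ℚ 0

∑₀-cong : ∀ n {f g : ℕ → ℚ} → (∀ i → i < n → f i ≡ g i) → ∑₀ n f ≡ ∑₀ n g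
∑₀-cong zero    f≡g = refl
∑₀-cong (suc n) f≡g = cong₂ _+ℚ_ (f≡g 0 (s≤s z≤n)) (∑₀-cong n (λ i i<n → f≡g (suc i) (s≤s i<n)))

∑₀-zero : ∀ n {f : ℕ → ℚ} → (∀ i → i < n → f i ≡ 0ℚ) → ∑₀ n f ≡ 0ℚ
∑₀-zero zero    f≡0 = refl
∑₀-zero (suc n) f≡0 = cong₂ _+ℚ_ (f≡0 0 (s≤s z≤n)) (∑₀-zero n (λ i i<n → f≡0 (suc i) (s≤s i<n)))

∑₀-distrib-+ : ∀ n (f g : ℕ → ℚ) → ∑₀ n (λ i → f i +ℚ g i) ≡ ∑₀ n f +ℚ ∑₀ n g
∑₀-distrib-+ n f g = ℚ-Sum.∑-distrib-+ {n} (f ∘ toℕ) (g ∘ toℕ)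

*-distribˡ-∑₀ : ∀ n c (f : ℕ → ℚ) → c *ℚ ∑₀ n f ≡ ∑₀ n (λ i → c *ℚ f i)
*-distribˡ-∑₀ n c f = ℚ-Sum.*-distribˡ-sum {n} c (f ∘ toℕ)

∑₀-comm : ∀ m n (f : ℕ → ℕ → ℚ) → ∑₀ m (λ i → ∑₀ n (f i)) ≡ ∑₀ n (λ j → ∑₀ m (λ i → f i j))
∑₀-comm m n f = ℚ-Sum.∑-comm {m} {n} (λ i j → f (toℕ i) (toℕ j))

∑₀-++ : ∀ m n (f : ℕ → ℚ) → ∑₀ (m + n) f ≡ ∑₀ m f +ℚ ∑₀ n (λ i → f (m + i))
∑₀-++ zero    n f = sym (ℚ.+-identityˡ _)
∑₀-++ (suc m) n f = trans (cong (f 0 +ℚ_) (∑₀-++ m n (f ∘ suc)))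
  (sym (ℚ.+-assoc (f 0) (∑₀ m (f ∘ suc)) (∑₀ n (λ i → f (suc m + i)))))

-- The cut-off of an infinite sum depends on the coefficient looked at; this makes two cut-offs
-- agree before finite sums are compared or exchanged.
∑₀-extend : ∀ {m n} (f : ℕ → ℚ) → m ≤ n → (∀ i → m ≤ i → f i ≡ 0ℚ) → ∑₀ m f ≡ ∑₀ n f
∑₀-extend {m} {n} f m≤n f≡0 = begin
  ∑₀ m f                                     ≡⟨ ℚ.+-identityʳ _ ⟨
  ∑₀ m f +ℚ 0ℚ                               ≡⟨ cong (∑₀ m f +ℚ_) (∑₀-zero (n ∸ m) (λ i _ → f≡0 (m + i) (ℕ.m≤m+n m i))) ⟨
  ∑₀ m f +ℚ ∑₀ (n ∸ m) (λ i → f (m + i))     ≡⟨ ∑₀-++ m (n ∸ m) f ⟨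
  ∑₀ (m + (n ∸ m)) f                         ≡⟨ cong (λ k → ∑₀ k f) (ℕ.m+[n∸m]≡n m≤n) ⟩
  ∑₀ n f                                     ∎

-- The ring of formal power series

private
  tail : Series → Series
  tail f m = f (suc m)

≈-refl : ∀ {f} → f ≈ f
≈-refl m = refl

≈-sym : ∀ {f g} → f ≈ g → g ≈ f
≈-sym f≈g m = sym (f≈g m)

≈-trans : ∀ {f g h} → f ≈ g → g ≈ h → f ≈ h
≈-trans f≈g g≈h m = trans (f≈g m) (g≈h m)

⊕-cong : ∀ {f f′ g g′} → f ≈ f′ → g ≈ g′ → f ⊕ g ≈ f′ ⊕ g′
⊕-cong p q m = cong₂ _+ℚ_ (p m) (q m)

⊖-cong : ∀ {f f′ g g′} → f ≈ f′ → g ≈ g′ → f ⊖ g ≈ f′ ⊖ g′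
⊖-cong p q m = cong₂ _-ℚ_ (p m) (q m)

·-congˡ : ∀ c {f g} → f ≈ g → c · f ≈ c · g
·-congˡ c f≈g m = cong (c *ℚ_) (f≈g m)

⊛-cong : ∀ {f f′ g g′} → f ≈ f′ → g ≈ g′ → f ⊛ g ≈ f′ ⊛ g′
⊛-cong p q m = ∑₀-cong (suc m) (λ i _ → cong₂ _*ℚ_ (p i) (q (m ∸ i)))

⊛-congˡ : ∀ f {g g′} → g ≈ g′ → f ⊛ g ≈ f ⊛ g′
⊛-congˡ f = ⊛-cong (≈-refl {f})

⊛-congʳ : ∀ g {f f′} → f ≈ f′ → f ⊛ g ≈ f′ ⊛ g
⊛-congʳ g f≈f′ = ⊛-cong f≈f′ (≈-refl {g})

⊛-distribˡ-⊕ : ∀ f g h → f ⊛ (g ⊕ h) ≈ f ⊛ g ⊕ f ⊛ h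
⊛-distribˡ-⊕ f g h m = trans
  (∑₀-cong (suc m) (λ i _ → ℚ.*-distribˡ-+ (f i) (g (m ∸ i)) (h (m ∸ i))))
  (∑₀-distrib-+ (suc m) (λ i → f i *ℚ g (m ∸ i)) (λ i → f i *ℚ h (m ∸ i)))

⊛-·ʳ : ∀ c f g → f ⊛ (c · g) ≈ c · (f ⊛ g)
⊛-·ʳ c f g m = trans
  (∑₀-cong (suc m) (λ i _ → solve 3 (λ a b c → b :* (a :* c) := a :* (b :* c)) refl c (f i) (g (m ∸ i))))
  (sym (*-distribˡ-∑₀ (suc m) c (λ i → f i *ℚ g (m ∸ i))))

-- The convolution unfolds at its first term. Commutativity reverses the sum, so its induction needs
-- the last term split off as well.
⊛-last : ∀ f g m → (f ⊛ g) (suc m) ≡ f (suc m) *ℚ g 0 +ℚ (f ⊛ tail g) m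
⊛-last f g zero =
  solve 4 (λ a b c d → a :* d :+ (c :* b :+ con 0ℚ) := c :* b :+ (a :* d :+ con 0ℚ)) refl (f 0) (g 0) (f 1) (g 1)
⊛-last f g (suc m) = trans
  (cong (f 0 *ℚ g (suc (suc m)) +ℚ_) (⊛-last (tail f) g m))
  (solve 3 (λ a b c → a :+ (b :+ c) := b :+ (a :+ c)) refl
    (f 0 *ℚ g (suc (suc m))) (f (suc (suc m)) *ℚ g 0) ((tail f ⊛ tail g) m))

⊛-comm : ∀ f g → f ⊛ g ≈ g ⊛ f
⊛-comm f g zero    = cong (_+ℚ 0ℚ) (ℚ.*-comm (f 0) (g 0))
⊛-comm f g (suc m) = trans (cong₂ _+ℚ_ (ℚ.*-comm (f 0) (g (suc m))) (⊛-comm (tail f) g m)) (sym (⊛-last g f m))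

⊛-distribʳ-⊕ : ∀ f g h → (g ⊕ h) ⊛ f ≈ g ⊛ f ⊕ h ⊛ f
⊛-distribʳ-⊕ f g h = ≈-trans (⊛-comm (g ⊕ h) f) (≈-trans (⊛-distribˡ-⊕ f g h) (⊕-cong (⊛-comm f g) (⊛-comm f h)))

⊛-·ˡ : ∀ c f g → (c · f) ⊛ g ≈ c · (f ⊛ g)
⊛-·ˡ c f g = ≈-trans (⊛-comm (c · f) g) (≈-trans (⊛-·ʳ c g f) (·-congˡ c (⊛-comm g f)))

⊛-assoc : ∀ f g h → (f ⊛ g) ⊛ h ≈ f ⊛ (g ⊛ h)
⊛-assoc f g h zero = solve 3 (λ a b c → (a :* b :+ con 0ℚ) :* c :+ con 0ℚ := a :* (b :* c :+ con 0ℚ) :+ con 0ℚ) refl (f 0) (g 0) (h 0)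
⊛-assoc f g h (suc m) = begin
  -- The tail of `f ⊛ g` unfolds to `f 0 · tail g ⊕ tail f ⊛ g`, so distributivity reduces the claim
  -- to the triple `tail f`, `g`, `h`.
  (f 0 *ℚ g 0 +ℚ 0ℚ) *ℚ h (suc m) +ℚ ((f 0 · tail g ⊕ tail f ⊛ g) ⊛ h) m
    ≡⟨ cong ((f 0 *ℚ g 0 +ℚ 0ℚ) *ℚ h (suc m) +ℚ_) (⊛-distribʳ-⊕ h (f 0 · tail g) (tail f ⊛ g) m) ⟩
  (f 0 *ℚ g 0 +ℚ 0ℚ) *ℚ h (suc m) +ℚ (((f 0 · tail g) ⊛ h) m +ℚ ((tail f ⊛ g) ⊛ h) m)
    ≡⟨ cong ((f 0 *ℚ g 0 +ℚ 0ℚ) *ℚ h (suc m) +ℚ_) (cong₂ _+ℚ_ (⊛-·ˡ (f 0) (tail g) h m) (⊛-assoc (tail f) g h m)) ⟩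
  (f 0 *ℚ g 0 +ℚ 0ℚ) *ℚ h (suc m) +ℚ (f 0 *ℚ (tail g ⊛ h) m +ℚ (tail f ⊛ (g ⊛ h)) m)
    ≡⟨ solve 5 (λ a b c d e → (a :* b :+ con 0ℚ) :* c :+ (a :* d :+ e) := a :* (b :* c :+ d) :+ e) refl
         (f 0) (g 0) (h (suc m)) ((tail g ⊛ h) m) ((tail f ⊛ (g ⊛ h)) m) ⟩
  f 0 *ℚ (g 0 *ℚ h (suc m) +ℚ (tail g ⊛ h) m) +ℚ (tail f ⊛ (g ⊛ h)) m ∎

⊛-zeroˡ : ∀ g → 𝟘 ⊛ g ≈ 𝟘
⊛-zeroˡ g m = ∑₀-zero (suc m) (λ i _ → ℚ.*-zeroˡ (g (m ∸ i)))

⊛-identityˡ : ∀ f → 𝟙 ⊛ f ≈ f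
⊛-identityˡ f zero    = trans (ℚ.+-identityʳ _) (ℚ.*-identityˡ _)
⊛-identityˡ f (suc m) = trans (cong₂ _+ℚ_ (ℚ.*-identityˡ (f (suc m))) (⊛-zeroˡ f m)) (ℚ.+-identityʳ _)

⊛-identityʳ : ∀ f → f ⊛ 𝟙 ≈ f
⊛-identityʳ f = ≈-trans (⊛-comm f 𝟙) (⊛-identityˡ f)

⊛^-cong : ∀ {f g} → f ≈ g → ∀ n → f ⊛^ n ≈ g ⊛^ n
⊛^-cong f≈g zero    = ≈-refl
⊛^-cong f≈g (suc n) = ⊛-cong f≈g (⊛^-cong f≈g n)

x^-⊛-x^ : ∀ k l → x^ k ⊛ x^ l ≈ x^ (k + l)
x^-⊛-x^ zero    l         = ⊛-identityˡ (x^ l)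
x^-⊛-x^ (suc k) l zero    = trans (ℚ.+-identityʳ _) (ℚ.*-zeroˡ ((x^ l) 0))
x^-⊛-x^ (suc k) l (suc m) = trans (cong₂ _+ℚ_ (ℚ.*-zeroˡ ((x^ l) (suc m))) (x^-⊛-x^ k l m)) (ℚ.+-identityˡ _)

x^-vanish : ∀ {k m} → m < k → (x^ k) m ≡ 0ℚ
x^-vanish {suc k} {zero}  _         = refl
x^-vanish {suc k} {suc m} (s≤s m<k) = x^-vanish m<k

-- Infinite sums and reciprocals

-- Divisibility of `F n` by x^n, the condition under which the cut-off built into `∑≥` loses
-- nothing.
Summable : (ℕ → Series) → Set
Summable F = ∀ n m → m < n → F n m ≡ 0ℚ

∑≥-cong : ∀ a {F G : ℕ → Series} → (∀ n → a ≤ n → F n ≈ G n) → ∑≥ a F ≈ ∑≥ a G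
∑≥-cong a F≈G m = ∑₀-cong (suc m ∸ a) (λ i _ → F≈G (a + i) (ℕ.m≤m+n a i) m)

⊛-distribˡ-∑≥ : ∀ a g F → Summable F → g ⊛ ∑≥ a F ≈ ∑≥ a (λ n → g ⊛ F n)
⊛-distribˡ-∑≥ a g F F-vanish m = begin
  ∑₀ (suc m) (λ i → g i *ℚ ∑₀ (suc (m ∸ i) ∸ a) (λ n → F (a + n) (m ∸ i)))
    -- The inner sum is cut off at `m ∸ i`. The terms from there to `m` are zero, and including them
    -- makes the range independent of `i`, so that the sums can be exchanged.
    ≡⟨ ∑₀-cong (suc m) (λ i _ → cong (g i *ℚ_) (∑₀-extend (λ n → F (a + n) (m ∸ i))
         (ℕ.∸-monoˡ-≤ a (s≤s (ℕ.m∸n≤m m i)))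
         (λ n le → F-vanish (a + n) (m ∸ i) (ℕ.≤-trans (ℕ.m≤n+m∸n _ a) (ℕ.+-monoʳ-≤ a le))))) ⟩
  ∑₀ (suc m) (λ i → g i *ℚ ∑₀ (suc m ∸ a) (λ n → F (a + n) (m ∸ i)))
    ≡⟨ ∑₀-cong (suc m) (λ i _ → *-distribˡ-∑₀ (suc m ∸ a) (g i) (λ n → F (a + n) (m ∸ i))) ⟩
  ∑₀ (suc m) (λ i → ∑₀ (suc m ∸ a) (λ n → g i *ℚ F (a + n) (m ∸ i)))
    ≡⟨ ∑₀-comm (suc m) (suc m ∸ a) (λ i n → g i *ℚ F (a + n) (m ∸ i)) ⟩
  ∑₀ (suc m ∸ a) (λ n → (g ⊛ F (a + n)) m) ∎

⊛^-summable : ∀ h → h 0 ≡ 0ℚ → Summable (h ⊛^_)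
⊛^-summable h h₀ (suc n) zero    _ = trans (ℚ.+-identityʳ _) (trans (cong (_*ℚ (h ⊛^ n) 0) h₀) (ℚ.*-zeroˡ ((h ⊛^ n) 0)))
⊛^-summable h h₀ (suc n) (suc m) (s≤s m<n) = begin
  h 0 *ℚ (h ⊛^ n) (suc m) +ℚ ∑₀ (suc m) (λ i → h (suc i) *ℚ (h ⊛^ n) (m ∸ i))
    ≡⟨ cong₂ _+ℚ_ (trans (cong (_*ℚ (h ⊛^ n) (suc m)) h₀) (ℚ.*-zeroˡ ((h ⊛^ n) (suc m))))
         (∑₀-zero (suc m) (λ i _ → trans (cong (h (suc i) *ℚ_)
           (⊛^-summable h h₀ n (m ∸ i) (ℕ.≤-<-trans (ℕ.m∸n≤m m i) m<n))) (ℚ.*-zeroʳ (h (suc i))))) ⟩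
  0ℚ ∎

recip-cong : ∀ {f g} → f ≈ g → recip f ≈ recip g
recip-cong f≈g = ∑≥-cong 0 (λ k _ → ⊛^-cong (⊖-cong (≈-refl {𝟙}) f≈g) k)

⊘-cong : ∀ {f f′ g g′} → f ≈ f′ → g ≈ g′ → f ⊘ g ≈ f′ ⊘ g′
⊘-cong f≈f′ g≈g′ = ⊛-cong f≈f′ (recip-cong g≈g′)

-- With h = 1 - f this is the telescoping of (1 - h) Σ h^k.
recip-inverse : ∀ f → f 0 ≡ 1ℚ → f ⊛ recip f ≈ 𝟙
recip-inverse f f₀ m = begin
  (f ⊛ recip f) m
    ≡⟨ ⊛-congʳ (recip f) (λ k → solve 2 (λ a b → b := a :+ con (ℚ.- 1ℚ) :* (a :- b)) refl (𝟙 k) (f k)) m ⟩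
  ((𝟙 ⊕ (ℚ.- 1ℚ) · h) ⊛ recip f) m
    ≡⟨ ⊛-distribʳ-⊕ (recip f) 𝟙 ((ℚ.- 1ℚ) · h) m ⟩
  (𝟙 ⊛ recip f) m +ℚ (((ℚ.- 1ℚ) · h) ⊛ recip f) m
    ≡⟨ cong₂ _+ℚ_ (⊛-identityˡ (recip f) m) (⊛-·ˡ (ℚ.- 1ℚ) h (recip f) m) ⟩
  recip f m +ℚ (ℚ.- 1ℚ) *ℚ (h ⊛ recip f) m
    ≡⟨ cong₂ (λ a b → a +ℚ (ℚ.- 1ℚ) *ℚ b)
         (∑₀-extend (λ k → (h ⊛^ k) m) (ℕ.n≤1+n (suc m)) (λ k m<k → h-summable k m m<k))
         (⊛-distribˡ-∑≥ 0 h (h ⊛^_) h-summable m) ⟩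
  (𝟙 m +ℚ ∑₀ (suc m) (λ k → (h ⊛^ suc k) m)) +ℚ (ℚ.- 1ℚ) *ℚ ∑₀ (suc m) (λ k → (h ⊛^ suc k) m)
    ≡⟨ solve 2 (λ a b → (a :+ b) :+ con (ℚ.- 1ℚ) :* b := a) refl (𝟙 m) (∑₀ (suc m) (λ k → (h ⊛^ suc k) m)) ⟩
  𝟙 m ∎
  where
  h : Series
  h = 𝟙 ⊖ f
  h-summable : Summable (h ⊛^_)
  h-summable = ⊛^-summable h (cong (1ℚ -ℚ_) f₀)

⊛^-constant : ∀ f → f 0 ≡ 1ℚ → ∀ n → (f ⊛^ n) 0 ≡ 1ℚ
⊛^-constant f f₀ zero    = refl
⊛^-constant f f₀ (suc n) = trans (ℚ.+-identityʳ _) (cong₂ _*ℚ_ f₀ (⊛^-constant f f₀ n))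

-- Reduces every expansion of a quotient to a product: it is enough to multiply the proposed
-- expansion by the denominator, which is invertible.
⊛-cancel-⊘ : ∀ c f g h → g 0 ≡ 1ℚ → g ⊛ h ≈ c · f → c · (f ⊘ g) ≈ h
⊛-cancel-⊘ c f g h g₀ gh≈cf = ≈-trans (≈-sym (⊛-·ˡ c f (recip g)))
  (≈-trans (⊛-congʳ (recip g) (≈-trans (≈-sym gh≈cf) (⊛-comm g h)))
  (≈-trans (⊛-assoc h g (recip g))
  (≈-trans (⊛-congˡ h (recip-inverse g g₀)) (⊛-identityʳ h))))

-- Natural numbers as rationals

private
  coprime-1 : ∀ n → Coprime n 1
  coprime-1 n = coprime-sym (1-coprimeTo n)

  -- `fromℕ n` divides out a gcd and is stuck for a variable `n`; the record form lets the rational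
  -- operations unfold.
  fromℕ-mkℚ : ∀ n → fromℕ n ≡ mkℚ (+ n) 0 (coprime-1 n)
  fromℕ-mkℚ n = ℚ.normalize-coprime (coprime-1 n)

fromℕ-homo-+ : ∀ m n → fromℕ (m + n) ≡ fromℕ m +ℚ fromℕ n
fromℕ-homo-+ m n = sym (begin
  fromℕ m +ℚ fromℕ n
    ≡⟨ cong₂ _+ℚ_ (fromℕ-mkℚ m) (fromℕ-mkℚ n) ⟩
  mkℚ (+ m) 0 (coprime-1 m) +ℚ mkℚ (+ n) 0 (coprime-1 n)
    ≡⟨ ℚ./-cong (cong₂ ℤ._+_ (ℤ.*-identityʳ (+ m)) (ℤ.*-identityʳ (+ n))) refl ⟩
  fromℕ (m + n) ∎)

fromℕ-homo-* : ∀ m n → fromℕ (m * n) ≡ fromℕ m *ℚ fromℕ n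
fromℕ-homo-* m n = sym (begin
  fromℕ m *ℚ fromℕ n
    ≡⟨ cong₂ _*ℚ_ (fromℕ-mkℚ m) (fromℕ-mkℚ n) ⟩
  mkℚ (+ m) 0 (coprime-1 m) *ℚ mkℚ (+ n) 0 (coprime-1 n)
    ≡⟨ ℚ./-cong (sym (ℤ.pos-* m n)) refl ⟩
  fromℕ (m * n) ∎)

fromℕ-homo-^ : ∀ m k → fromℕ (m ^ k) ≡ fromℕ m ^ℚ k
fromℕ-homo-^ m zero    = refl
fromℕ-homo-^ m (suc k) = trans (fromℕ-homo-* m (m ^ k)) (cong (fromℕ m *ℚ_) (fromℕ-homo-^ m k))

fromℕ-suc : ∀ n → fromℕ (suc n) ≡ fromℕ n +ℚ 1ℚ
fromℕ-suc n = trans (fromℕ-homo-+ 1 n) (ℚ.+-comm 1ℚ (fromℕ n))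

n/2≡½*n : ∀ n → + n ℚ./ 2 ≡ ½ *ℚ fromℕ n
n/2≡½*n n = sym (trans (cong (½ *ℚ_) (fromℕ-mkℚ n)) (ℚ./-cong (ℤ.*-identityˡ (+ n)) refl))

n/4≡¼*n : ∀ n → + n ℚ./ 4 ≡ (½ *ℚ ½) *ℚ fromℕ n
n/4≡¼*n n = sym (trans (cong ((½ *ℚ ½) *ℚ_) (fromℕ-mkℚ n)) (ℚ./-cong (ℤ.*-identityˡ (+ n)) refl))

-- Central factorials

rootProduct : ℕ → (ℕ → ℚ) → ℚ → ℚ
rootProduct zero    c w = 1ℚ
rootProduct (suc n) c w = (w -ℚ c 0) *ℚ rootProduct n (c ∘ suc) w

-- The recursion removes the first root, as `∏<` does, whereas passing from t to t + 1 in `Φ` and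
-- `Ψ` adds a last one.
rootProduct-snoc : ∀ n c w → rootProduct (suc n) c w ≡ rootProduct n c w *ℚ (w -ℚ c n)
rootProduct-snoc zero    c w = ℚ.*-comm (w -ℚ c 0) 1ℚ
rootProduct-snoc (suc n) c w = trans
  (cong ((w -ℚ c 0) *ℚ_) (rootProduct-snoc n (c ∘ suc) w))
  (sym (ℚ.*-assoc (w -ℚ c 0) (rootProduct n (c ∘ suc) w) (w -ℚ c (suc n))))

-- Written as in `tₑ` and `tₒ` with the index shifted by one, so that the products there unfold to
-- `rootPoly`.
rootsₑ rootsₒ : ℕ → ℚ
rootsₑ j = fromℕ (suc j ^ 2)
rootsₒ j = + ((2 * suc j ∸ 1) ^ 2) ℚ./ 4

rootsₑ-square : ∀ j → rootsₑ j ≡ (fromℕ j +ℚ 1ℚ) *ℚ (fromℕ j +ℚ 1ℚ)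
rootsₑ-square j = trans (fromℕ-homo-^ (suc j) 2)
  (trans (cong (fromℕ (suc j) *ℚ_) (ℚ.*-identityʳ (fromℕ (suc j)))) (cong₂ _*ℚ_ (fromℕ-suc j) (fromℕ-suc j)))

fromℕ-odd : ∀ j → fromℕ (2 * suc j ∸ 1) ≡ fromℕ 2 *ℚ fromℕ j +ℚ 1ℚ
fromℕ-odd j = begin
  fromℕ (2 * suc j ∸ 1)         ≡⟨ cong (λ k → fromℕ (k ∸ 1)) (ℕ.*-suc 2 j) ⟩
  fromℕ (suc (2 * j))           ≡⟨ fromℕ-suc (2 * j) ⟩
  fromℕ (2 * j) +ℚ 1ℚ           ≡⟨ cong (_+ℚ 1ℚ) (fromℕ-homo-* 2 j) ⟩
  fromℕ 2 *ℚ fromℕ j +ℚ 1ℚ      ∎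

rootsₒ-square : ∀ j → rootsₒ j ≡ (fromℕ j +ℚ ½) *ℚ (fromℕ j +ℚ ½)
rootsₒ-square j = begin
  + ((2 * suc j ∸ 1) ^ 2) ℚ./ 4
    ≡⟨ n/4≡¼*n ((2 * suc j ∸ 1) ^ 2) ⟩
  (½ *ℚ ½) *ℚ fromℕ ((2 * suc j ∸ 1) ^ 2)
    ≡⟨ cong ((½ *ℚ ½) *ℚ_) (trans (fromℕ-homo-^ (2 * suc j ∸ 1) 2) (cong (_^ℚ 2) (fromℕ-odd j))) ⟩
  (½ *ℚ ½) *ℚ ((fromℕ 2 *ℚ fromℕ j +ℚ 1ℚ) *ℚ ((fromℕ 2 *ℚ fromℕ j +ℚ 1ℚ) *ℚ 1ℚ))
    ≡⟨ solve 1 (λ a → con (½ *ℚ ½) :* ((con (fromℕ 2) :* a :+ con 1ℚ) :* ((con (fromℕ 2) :* a :+ con 1ℚ) :* con 1ℚ))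
                   := (a :+ con ½) :* (a :+ con ½)) refl (fromℕ j) ⟩
  (fromℕ j +ℚ ½) *ℚ (fromℕ j +ℚ ½) ∎

-- Φ t belongs to s = t + 1, whereas Ψ t belongs to s = t.
Φ Ψ : ℕ → ℚ → ℚ
Φ t z = z *ℚ rootProduct t rootsₑ (z *ℚ z)
Ψ t z = rootProduct t rootsₒ ((z -ℚ ½) *ℚ (z -ℚ ½))

Φ-suc : ∀ t z → Φ (suc t) z ≡ Φ t z *ℚ (z *ℚ z -ℚ (fromℕ t +ℚ 1ℚ) *ℚ (fromℕ t +ℚ 1ℚ))
Φ-suc t z = begin
  z *ℚ rootProduct (suc t) rootsₑ (z *ℚ z)
    ≡⟨ cong (z *ℚ_) (rootProduct-snoc t rootsₑ (z *ℚ z)) ⟩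
  z *ℚ (rootProduct t rootsₑ (z *ℚ z) *ℚ (z *ℚ z -ℚ rootsₑ t))
    ≡⟨ ℚ.*-assoc z (rootProduct t rootsₑ (z *ℚ z)) (z *ℚ z -ℚ rootsₑ t) ⟨
  Φ t z *ℚ (z *ℚ z -ℚ rootsₑ t)
    ≡⟨ cong (λ c → Φ t z *ℚ (z *ℚ z -ℚ c)) (rootsₑ-square t) ⟩
  Φ t z *ℚ (z *ℚ z -ℚ (fromℕ t +ℚ 1ℚ) *ℚ (fromℕ t +ℚ 1ℚ)) ∎

Ψ-suc : ∀ t z → Ψ (suc t) z ≡ Ψ t z *ℚ ((z -ℚ ½) *ℚ (z -ℚ ½) -ℚ (fromℕ t +ℚ ½) *ℚ (fromℕ t +ℚ ½))
Ψ-suc t z = trans (rootProduct-snoc t rootsₒ ((z -ℚ ½) *ℚ (z -ℚ ½)))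
  (cong (λ c → Ψ t z *ℚ ((z -ℚ ½) *ℚ (z -ℚ ½) -ℚ c)) (rootsₒ-square t))

-- Φ t z is the product of z - t, …, z + t and Ψ t (z + 1) that of z - t + 1, …, z + t.
Φ≡[z-t]Ψ : ∀ t z → Φ t z ≡ (z -ℚ fromℕ t) *ℚ Ψ t (z +ℚ 1ℚ)
Φ≡[z-t]Ψ zero    z = solve 1 (λ z → z :* con 1ℚ := (z :- con 0ℚ) :* con 1ℚ) refl z
Φ≡[z-t]Ψ (suc t) z = begin
  Φ (suc t) z
    ≡⟨ Φ-suc t z ⟩
  Φ t z *ℚ (z *ℚ z -ℚ (fromℕ t +ℚ 1ℚ) *ℚ (fromℕ t +ℚ 1ℚ))
    ≡⟨ cong (_*ℚ (z *ℚ z -ℚ (fromℕ t +ℚ 1ℚ) *ℚ (fromℕ t +ℚ 1ℚ))) (Φ≡[z-t]Ψ t z) ⟩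
  (z -ℚ fromℕ t) *ℚ Ψ t (z +ℚ 1ℚ) *ℚ (z *ℚ z -ℚ (fromℕ t +ℚ 1ℚ) *ℚ (fromℕ t +ℚ 1ℚ))
    ≡⟨ solve 3 (λ z t P → (z :- t) :* P :* (z :* z :- (t :+ con 1ℚ) :* (t :+ con 1ℚ))
         := (z :- (t :+ con 1ℚ)) :* (P :* (((z :+ con 1ℚ) :- con ½) :* ((z :+ con 1ℚ) :- con ½) :- (t :+ con ½) :* (t :+ con ½))))
         refl z (fromℕ t) (Ψ t (z +ℚ 1ℚ)) ⟩
  (z -ℚ (fromℕ t +ℚ 1ℚ)) *ℚ (Ψ t (z +ℚ 1ℚ) *ℚ (((z +ℚ 1ℚ) -ℚ ½) *ℚ ((z +ℚ 1ℚ) -ℚ ½) -ℚ (fromℕ t +ℚ ½) *ℚ (fromℕ t +ℚ ½)))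
    ≡⟨ cong₂ (λ a b → (z -ℚ a) *ℚ b) (fromℕ-suc t) (Ψ-suc t (z +ℚ 1ℚ)) ⟨
  (z -ℚ fromℕ (suc t)) *ℚ Ψ (suc t) (z +ℚ 1ℚ) ∎

-- `Ψ t z` is the product of z - t, ..., z + t - 1; the factor z + t is missing at the top.
Φ≡[z+t]Ψ : ∀ t z → Φ t z ≡ (z +ℚ fromℕ t) *ℚ Ψ t z
Φ≡[z+t]Ψ zero    z = solve 1 (λ z → z :* con 1ℚ := (z :+ con 0ℚ) :* con 1ℚ) refl z
Φ≡[z+t]Ψ (suc t) z = begin
  Φ (suc t) z
    ≡⟨ Φ-suc t z ⟩
  Φ t z *ℚ (z *ℚ z -ℚ (fromℕ t +ℚ 1ℚ) *ℚ (fromℕ t +ℚ 1ℚ))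
    ≡⟨ cong (_*ℚ (z *ℚ z -ℚ (fromℕ t +ℚ 1ℚ) *ℚ (fromℕ t +ℚ 1ℚ))) (Φ≡[z+t]Ψ t z) ⟩
  (z +ℚ fromℕ t) *ℚ Ψ t z *ℚ (z *ℚ z -ℚ (fromℕ t +ℚ 1ℚ) *ℚ (fromℕ t +ℚ 1ℚ))
    ≡⟨ solve 3 (λ z t P → (z :+ t) :* P :* (z :* z :- (t :+ con 1ℚ) :* (t :+ con 1ℚ))
         := (z :+ (t :+ con 1ℚ)) :* (P :* ((z :- con ½) :* (z :- con ½) :- (t :+ con ½) :* (t :+ con ½))))
         refl z (fromℕ t) (Ψ t z) ⟩
  (z +ℚ (fromℕ t +ℚ 1ℚ)) *ℚ (Ψ t z *ℚ ((z -ℚ ½) *ℚ (z -ℚ ½) -ℚ (fromℕ t +ℚ ½) *ℚ (fromℕ t +ℚ ½)))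
    ≡⟨ cong₂ (λ a b → (z +ℚ a) *ℚ b) (fromℕ-suc t) (Ψ-suc t z) ⟨
  (z +ℚ fromℕ (suc t)) *ℚ Ψ (suc t) z ∎

-- `Ψ (suc t) z` is the product of z - t - 1, ..., z + t, one factor more than `Φ t z` at the
-- bottom. After the shift to z + 1 the extra factor sits at the top instead.
Ψ[1+t]≡[z-1-t]Φ : ∀ t z → Ψ (suc t) z ≡ (z -ℚ (fromℕ t +ℚ 1ℚ)) *ℚ Φ t z
Ψ[1+t]≡[z-1-t]Φ t z = begin
  Ψ (suc t) z
    ≡⟨ Ψ-suc t z ⟩
  Ψ t z *ℚ ((z -ℚ ½) *ℚ (z -ℚ ½) -ℚ (fromℕ t +ℚ ½) *ℚ (fromℕ t +ℚ ½))
    ≡⟨ solve 3 (λ z t P → P :* ((z :- con ½) :* (z :- con ½) :- (t :+ con ½) :* (t :+ con ½))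
         := (z :- (t :+ con 1ℚ)) :* ((z :+ t) :* P)) refl z (fromℕ t) (Ψ t z) ⟩
  (z -ℚ (fromℕ t +ℚ 1ℚ)) *ℚ ((z +ℚ fromℕ t) *ℚ Ψ t z)
    ≡⟨ cong ((z -ℚ (fromℕ t +ℚ 1ℚ)) *ℚ_) (Φ≡[z+t]Ψ t z) ⟨
  (z -ℚ (fromℕ t +ℚ 1ℚ)) *ℚ Φ t z ∎

Ψ[1+t][z+1]≡[z+1+t]Φ : ∀ t z → Ψ (suc t) (z +ℚ 1ℚ) ≡ (z +ℚ (fromℕ t +ℚ 1ℚ)) *ℚ Φ t z
Ψ[1+t][z+1]≡[z+1+t]Φ t z = begin
  Ψ (suc t) (z +ℚ 1ℚ)
    ≡⟨ Ψ-suc t (z +ℚ 1ℚ) ⟩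
  Ψ t (z +ℚ 1ℚ) *ℚ (((z +ℚ 1ℚ) -ℚ ½) *ℚ ((z +ℚ 1ℚ) -ℚ ½) -ℚ (fromℕ t +ℚ ½) *ℚ (fromℕ t +ℚ ½))
    ≡⟨ solve 3 (λ z t P → P :* (((z :+ con 1ℚ) :- con ½) :* ((z :+ con 1ℚ) :- con ½) :- (t :+ con ½) :* (t :+ con ½))
         := (z :+ (t :+ con 1ℚ)) :* ((z :- t) :* P)) refl z (fromℕ t) (Ψ t (z +ℚ 1ℚ)) ⟩
  (z +ℚ (fromℕ t +ℚ 1ℚ)) *ℚ ((z -ℚ fromℕ t) *ℚ Ψ t (z +ℚ 1ℚ))
    ≡⟨ cong ((z +ℚ (fromℕ t +ℚ 1ℚ)) *ℚ_) (Φ≡[z-t]Ψ t z) ⟨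
  (z +ℚ (fromℕ t +ℚ 1ℚ)) *ℚ Φ t z ∎

private
  fromℕ-2t+1 : ∀ t → fromℕ (suc (2 * t)) ≡ fromℕ 2 *ℚ fromℕ t +ℚ 1ℚ
  fromℕ-2t+1 t = trans (fromℕ-suc (2 * t)) (cong (_+ℚ 1ℚ) (fromℕ-homo-* 2 t))

  fromℕ-2t+2 : ∀ t → fromℕ (suc (suc (2 * t))) ≡ fromℕ 2 *ℚ fromℕ t +ℚ 1ℚ +ℚ 1ℚ
  fromℕ-2t+2 t = trans (fromℕ-suc (suc (2 * t))) (cong (_+ℚ 1ℚ) (fromℕ-2t+1 t))

-- Both products contain the factors of `Ψ t (l + 1)`; the factors left over differ by (l + 1 + t) -
-- (l - t) = 2t + 1.
Φ-difference : ∀ t l → Φ t (fromℕ (suc l)) -ℚ Φ t (fromℕ l) ≡ fromℕ (suc (2 * t)) *ℚ Ψ t (fromℕ (suc l))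
Φ-difference t l rewrite fromℕ-suc l | fromℕ-2t+1 t | Φ≡[z+t]Ψ t (fromℕ l +ℚ 1ℚ) | Φ≡[z-t]Ψ t (fromℕ l) =
  solve 3 (λ z t P → (z :+ con 1ℚ :+ t) :* P :- (z :- t) :* P := (con (fromℕ 2) :* t :+ con 1ℚ) :* P)
    refl (fromℕ l) (fromℕ t) (Ψ t (fromℕ l +ℚ 1ℚ))

-- The common part is now `Φ t l`, and (l + t + 1) - (l - t - 1) = 2t + 2. Multiplied alternately,
-- the two constants build up the factorials.
Ψ-difference : ∀ t l → Ψ (suc t) (fromℕ (suc l)) -ℚ Ψ (suc t) (fromℕ l) ≡ fromℕ (suc (suc (2 * t))) *ℚ Φ t (fromℕ l)
Ψ-difference t l = begin
  Ψ (suc t) (fromℕ (suc l)) -ℚ Ψ (suc t) (fromℕ l)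
    ≡⟨ cong₂ _-ℚ_ (trans (cong (Ψ (suc t)) (fromℕ-suc l)) (Ψ[1+t][z+1]≡[z+1+t]Φ t (fromℕ l))) (Ψ[1+t]≡[z-1-t]Φ t (fromℕ l)) ⟩
  (fromℕ l +ℚ (fromℕ t +ℚ 1ℚ)) *ℚ Φ t (fromℕ l) -ℚ (fromℕ l -ℚ (fromℕ t +ℚ 1ℚ)) *ℚ Φ t (fromℕ l)
    ≡⟨ solve 3 (λ z t P → (z :+ (t :+ con 1ℚ)) :* P :- (z :- (t :+ con 1ℚ)) :* P := (con (fromℕ 2) :* t :+ con 1ℚ :+ con 1ℚ) :* P)
         refl (fromℕ l) (fromℕ t) (Φ t (fromℕ l)) ⟩
  (fromℕ 2 *ℚ fromℕ t +ℚ 1ℚ +ℚ 1ℚ) *ℚ Φ t (fromℕ l)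
    ≡⟨ cong (_*ℚ Φ t (fromℕ l)) (fromℕ-2t+2 t) ⟨
  fromℕ (suc (suc (2 * t))) *ℚ Φ t (fromℕ l) ∎

Φ-zero : ∀ t → Φ t 0ℚ ≡ 0ℚ
Φ-zero t = ℚ.*-zeroˡ (rootProduct t rootsₑ 0ℚ)

-- Removes the head term when `telescope` is applied to `Odd (suc t)`.
Ψ[1+t]-one : ∀ t → Ψ (suc t) 1ℚ ≡ 0ℚ
Ψ[1+t]-one t = trans (Ψ[1+t][z+1]≡[z+1+t]Φ t 0ℚ)
  (trans (cong ((0ℚ +ℚ (fromℕ t +ℚ 1ℚ)) *ℚ_) (Φ-zero t)) (ℚ.*-zeroʳ (0ℚ +ℚ (fromℕ t +ℚ 1ℚ))))

-- Polynomials given by their roots, and central factorial numbers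

x^-⊛ : ∀ k g m → (x^ k ⊛ g) (k + m) ≡ g m
x^-⊛ zero    g m = ⊛-identityˡ g m
x^-⊛ (suc k) g m = trans (cong₂ _+ℚ_ (ℚ.*-zeroˡ (g (suc (k + m)))) (x^-⊛ k g m)) (ℚ.+-identityˡ (g m))

-- Serves both kinds of factor in use: `x^ 2 ⊖ c · 𝟙` for a root and `𝟙 ⊖ δ · x^ d` for a
-- denominator.
⊖·-⊛ : ∀ f c g h → (f ⊖ c · g) ⊛ h ≈ f ⊛ h ⊖ c · (g ⊛ h)
⊖·-⊛ f c g h m = begin
  ((f ⊖ c · g) ⊛ h) m
    ≡⟨ ⊛-congʳ h (λ k → solve 3 (λ a b c → a :- c :* b := a :+ (:- c) :* b) refl (f k) (g k) c) m ⟩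
  ((f ⊕ (ℚ.- c) · g) ⊛ h) m
    ≡⟨ ⊛-distribʳ-⊕ h f ((ℚ.- c) · g) m ⟩
  (f ⊛ h) m +ℚ (((ℚ.- c) · g) ⊛ h) m
    ≡⟨ cong ((f ⊛ h) m +ℚ_) (⊛-·ˡ (ℚ.- c) g h m) ⟩
  (f ⊛ h) m +ℚ (ℚ.- c) *ℚ (g ⊛ h) m
    ≡⟨ solve 3 (λ a b c → a :+ (:- c) :* b := a :- c :* b) refl ((f ⊛ h) m) ((g ⊛ h) m) c ⟩
  (f ⊛ h) m -ℚ c *ℚ (g ⊛ h) m ∎

-- A polynomial in w = x²; `rootCoeff` reads off its coefficients in w, so that it can be evaluated
-- at a rational number.
rootPoly : ℕ → (ℕ → ℚ) → Series
rootPoly n c = ∏[ 0 ≤ j < n ] (x^ 2 ⊖ c j · 𝟙)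

rootCoeff : ℕ → (ℕ → ℚ) → ℕ → ℚ
rootCoeff n c r = rootPoly n c (2 * r)

rootCoeff-zero : ∀ n c → rootCoeff (suc n) c 0 ≡ (ℚ.- c 0) *ℚ rootCoeff n (c ∘ suc) 0
rootCoeff-zero n c = begin
  ((x^ 2 ⊖ c 0 · 𝟙) ⊛ g) 0            ≡⟨ ⊖·-⊛ (x^ 2) (c 0) 𝟙 g 0 ⟩
  (x^ 2 ⊛ g) 0 -ℚ c 0 *ℚ (𝟙 ⊛ g) 0    ≡⟨ cong (λ b → (x^ 2 ⊛ g) 0 -ℚ c 0 *ℚ b) (⊛-identityˡ g 0) ⟩
  (x^ 2 ⊛ g) 0 -ℚ c 0 *ℚ g 0          ≡⟨ solve 2 (λ c g → (con 0ℚ :* g :+ con 0ℚ) :- c :* g := (:- c) :* g) refl (c 0) (g 0) ⟩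
  (ℚ.- c 0) *ℚ g 0                    ∎
  where
  g : Series
  g = rootPoly n (c ∘ suc)

rootCoeff-suc : ∀ n c r → rootCoeff (suc n) c (suc r) ≡ rootCoeff n (c ∘ suc) r -ℚ c 0 *ℚ rootCoeff n (c ∘ suc) (suc r)
rootCoeff-suc n c r = begin
  ((x^ 2 ⊖ c 0 · 𝟙) ⊛ g) (2 * suc r)                     ≡⟨ ⊖·-⊛ (x^ 2) (c 0) 𝟙 g (2 * suc r) ⟩
  (x^ 2 ⊛ g) (2 * suc r) -ℚ c 0 *ℚ (𝟙 ⊛ g) (2 * suc r)   ≡⟨ cong₂ (λ a b → a -ℚ c 0 *ℚ b)
                                                              (trans (cong (x^ 2 ⊛ g) (ℕ.*-suc 2 r)) (x^-⊛ 2 g (2 * r)))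
                                                              (⊛-identityˡ g (2 * suc r)) ⟩
  g (2 * r) -ℚ c 0 *ℚ g (2 * suc r)                      ∎
  where
  g : Series
  g = rootPoly n (c ∘ suc)

rootCoeff-vanish : ∀ n c r → n < r → rootCoeff n c r ≡ 0ℚ
rootCoeff-vanish zero    c (suc r) _         = refl
rootCoeff-vanish (suc n) c (suc r) (s≤s n<r) = begin
  rootCoeff (suc n) c (suc r)
    ≡⟨ rootCoeff-suc n c r ⟩
  rootCoeff n (c ∘ suc) r -ℚ c 0 *ℚ rootCoeff n (c ∘ suc) (suc r)
    ≡⟨ cong₂ (λ a b → a -ℚ c 0 *ℚ b) (rootCoeff-vanish n (c ∘ suc) r n<r)
         (rootCoeff-vanish n (c ∘ suc) (suc r) (ℕ.m≤n⇒m≤1+n n<r)) ⟩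
  0ℚ -ℚ c 0 *ℚ 0ℚ
    ≡⟨ solve 1 (λ c → con 0ℚ :- c :* con 0ℚ := con 0ℚ) refl (c 0) ⟩
  0ℚ ∎

-- Multiplying the polynomial by x² - c 0 acts on its coefficients as multiplying its value by w - c
-- 0.
rootCoeff-eval : ∀ n c w → ∑₀ (suc n) (λ r → rootCoeff n c r *ℚ w ^ℚ r) ≡ rootProduct n c w
rootCoeff-eval zero    c w = refl
rootCoeff-eval (suc n) c w = begin
  rootCoeff (suc n) c 0 *ℚ 1ℚ +ℚ ∑₀ (suc n) (λ r → rootCoeff (suc n) c (suc r) *ℚ w ^ℚ suc r)
    ≡⟨ cong₂ (λ a b → a *ℚ 1ℚ +ℚ b) (rootCoeff-zero n c) (trans (∑₀-cong (suc n) (λ r _ → step r)) split) ⟩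
  ((ℚ.- c 0) *ℚ e 0) *ℚ 1ℚ +ℚ (w *ℚ val +ℚ (ℚ.- c 0) *ℚ val₊)
    ≡⟨ solve 5 (λ c e w val val₊ → ((:- c) :* e) :* con 1ℚ :+ (w :* val :+ (:- c) :* val₊) := w :* val :- c :* (e :* con 1ℚ :+ val₊))
         refl (c 0) (e 0) w val val₊ ⟩
  w *ℚ val -ℚ c 0 *ℚ ∑₀ (suc (suc n)) (λ r → e r *ℚ w ^ℚ r)
    -- The shifted sum `val₊` reaches one index further than `val`; the coefficient there is beyond
    -- the degree and vanishes.
    ≡⟨ cong (λ a → w *ℚ val -ℚ c 0 *ℚ a) (∑₀-extend (λ r → e r *ℚ w ^ℚ r) (ℕ.n≤1+n (suc n))
         (λ r n<r → trans (cong (_*ℚ w ^ℚ r) (rootCoeff-vanish n (c ∘ suc) r n<r)) (ℚ.*-zeroˡ (w ^ℚ r)))) ⟨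
  w *ℚ val -ℚ c 0 *ℚ val
    ≡⟨ solve 3 (λ c w val → w :* val :- c :* val := (w :- c) :* val) refl (c 0) w val ⟩
  (w -ℚ c 0) *ℚ val
    ≡⟨ cong ((w -ℚ c 0) *ℚ_) (rootCoeff-eval n (c ∘ suc) w) ⟩
  (w -ℚ c 0) *ℚ rootProduct n (c ∘ suc) w ∎
  where
  e : ℕ → ℚ
  e = rootCoeff n (c ∘ suc)
  val val₊ : ℚ
  val  = ∑₀ (suc n) (λ r → e r *ℚ w ^ℚ r)
  val₊ = ∑₀ (suc n) (λ r → e (suc r) *ℚ w ^ℚ suc r)
  step : ∀ r → rootCoeff (suc n) c (suc r) *ℚ w ^ℚ suc r
             ≡ w *ℚ (e r *ℚ w ^ℚ r) +ℚ (ℚ.- c 0) *ℚ (e (suc r) *ℚ w ^ℚ suc r)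
  step r = trans (cong (_*ℚ w ^ℚ suc r) (rootCoeff-suc n c r))
    (solve 5 (λ c w a b v → (a :- c :* b) :* (w :* v) := w :* (a :* v) :+ (:- c) :* (b :* (w :* v)))
      refl (c 0) w (e r) (e (suc r)) (w ^ℚ r))
  split : ∑₀ (suc n) (λ r → w *ℚ (e r *ℚ w ^ℚ r) +ℚ (ℚ.- c 0) *ℚ (e (suc r) *ℚ w ^ℚ suc r)) ≡ w *ℚ val +ℚ (ℚ.- c 0) *ℚ val₊
  split = trans (∑₀-distrib-+ (suc n) (λ r → w *ℚ (e r *ℚ w ^ℚ r)) (λ r → (ℚ.- c 0) *ℚ (e (suc r) *ℚ w ^ℚ suc r)))
    (sym (cong₂ _+ℚ_ (*-distribˡ-∑₀ (suc n) w (λ r → e r *ℚ w ^ℚ r))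
                     (*-distribˡ-∑₀ (suc n) (ℚ.- c 0) (λ r → e (suc r) *ℚ w ^ℚ suc r))))

tₑ-suc : ∀ t r → tₑ (suc t) (suc r) ≡ rootCoeff t rootsₑ r
tₑ-suc t r = trans (cong (x^ 2 ⊛ rootPoly t rootsₑ) (ℕ.*-suc 2 r)) (x^-⊛ 2 (rootPoly t rootsₑ) (2 * r))

tₒ≡rootCoeff : ∀ s r → tₒ s r ≡ rootCoeff s rootsₒ r
tₒ≡rootCoeff s r = trans (cong (x^ 1 ⊛ rootPoly s rootsₒ) (ℕ.+-comm (2 * r) 1)) (x^-⊛ 1 (rootPoly s rootsₒ) (2 * r))

tₑ-vanish : ∀ t r → suc t < r → tₑ (suc t) r ≡ 0ℚ
tₑ-vanish t (suc r) (s≤s t<r) = trans (tₑ-suc t r) (rootCoeff-vanish t rootsₑ r t<r)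

tₒ-vanish : ∀ s r → s < r → tₒ s r ≡ 0ℚ
tₒ-vanish s r s<r = trans (tₒ≡rootCoeff s r) (rootCoeff-vanish s rootsₒ r s<r)

^ℚ-double : ∀ z r → (z *ℚ z) ^ℚ r ≡ z ^ℚ (2 * r)
^ℚ-double z r = trans (cong (λ y → (z *ℚ y) ^ℚ r) (sym (ℚ.*-identityʳ z))) (ℚ-Exp.^-assocʳ z 2 r)

Φ-expand : ∀ t z → Φ t z ≡ ∑ℚ 1 (suc (suc t)) (λ r → tₑ (suc t) r *ℚ z ^ℚ (2 * r ∸ 1))
Φ-expand t z = begin
  z *ℚ rootProduct t rootsₑ (z *ℚ z)
    ≡⟨ cong (z *ℚ_) (rootCoeff-eval t rootsₑ (z *ℚ z)) ⟨
  z *ℚ ∑₀ (suc t) (λ r → rootCoeff t rootsₑ r *ℚ (z *ℚ z) ^ℚ r)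
    ≡⟨ *-distribˡ-∑₀ (suc t) z (λ r → rootCoeff t rootsₑ r *ℚ (z *ℚ z) ^ℚ r) ⟩
  ∑₀ (suc t) (λ r → z *ℚ (rootCoeff t rootsₑ r *ℚ (z *ℚ z) ^ℚ r))
    ≡⟨ ∑₀-cong (suc t) (λ r _ → term r) ⟩
  ∑ℚ 1 (suc (suc t)) (λ r → tₑ (suc t) r *ℚ z ^ℚ (2 * r ∸ 1)) ∎
  where
  term : ∀ r → z *ℚ (rootCoeff t rootsₑ r *ℚ (z *ℚ z) ^ℚ r) ≡ tₑ (suc t) (suc r) *ℚ z ^ℚ (2 * suc r ∸ 1)
  term r = begin
    z *ℚ (rootCoeff t rootsₑ r *ℚ (z *ℚ z) ^ℚ r)
      ≡⟨ solve 3 (λ a b c → a :* (b :* c) := b :* (a :* c)) refl z (rootCoeff t rootsₑ r) ((z *ℚ z) ^ℚ r) ⟩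
    rootCoeff t rootsₑ r *ℚ (z *ℚ (z *ℚ z) ^ℚ r)
      ≡⟨ cong₂ _*ℚ_ (sym (tₑ-suc t r)) (cong (z *ℚ_) (^ℚ-double z r)) ⟩
    tₑ (suc t) (suc r) *ℚ z ^ℚ suc (2 * r)
      ≡⟨ cong (λ k → tₑ (suc t) (suc r) *ℚ z ^ℚ (k ∸ 1)) (ℕ.*-suc 2 r) ⟨
    tₑ (suc t) (suc r) *ℚ z ^ℚ (2 * suc r ∸ 1) ∎

Ψ-expand : ∀ s z → Ψ s z ≡ ∑ℚ 0 (suc s) (λ r → tₒ s r *ℚ (z -ℚ ½) ^ℚ (2 * r))
Ψ-expand s z = trans (sym (rootCoeff-eval s rootsₒ ((z -ℚ ½) *ℚ (z -ℚ ½))))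
  (∑₀-cong (suc s) (λ r _ → cong₂ _*ℚ_ (sym (tₒ≡rootCoeff s r)) (^ℚ-double (z -ℚ ½) r)))

-- Lacunary series

-- Makes x^(e l) divisible by x^l, so that `lacunary` sums are not affected by their cut-off.
Expanding : (ℕ → ℕ) → Set
Expanding e = ∀ n → n ≤ e n

lacunary : (ℕ → ℕ) → (ℕ → ℚ) → Series
lacunary e b = ∑[ l ≥ 1 ] b l · x^ (e l)

·x^-summable : ∀ e (b : ℕ → ℚ) → Expanding e → Summable (λ l → b l · x^ (e l))
·x^-summable e b e≥ l m m<l = trans (cong (b l *ℚ_) (x^-vanish (ℕ.≤-trans m<l (e≥ l)))) (ℚ.*-zeroʳ (b l))

lacunary-cong : ∀ e e′ b b′ → (∀ l → e (suc l) ≡ e′ (suc l)) → (∀ l → b (suc l) ≡ b′ (suc l)) →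
                lacunary e b ≈ lacunary e′ b′
lacunary-cong e e′ b b′ e≡e′ b≡b′ m = ∑₀-cong m (λ l _ → cong₂ (λ k c → c *ℚ (x^ k) m) (e≡e′ l) (b≡b′ l))

lacunary-· : ∀ c e b → lacunary e (λ l → c *ℚ b l) ≈ c · lacunary e b
lacunary-· c e b m = trans
  (∑₀-cong m (λ l _ → ℚ.*-assoc c (b (suc l)) ((x^ e (suc l)) m)))
  (sym (*-distribˡ-∑₀ m c (λ l → b (suc l) *ℚ (x^ e (suc l)) m)))

lacunary-zero : ∀ e b → (∀ l → b (suc l) ≡ 0ℚ) → lacunary e b ≈ 𝟘
lacunary-zero e b b≡0 m = ∑₀-zero m (λ l _ → trans (cong (_*ℚ (x^ e (suc l)) m) (b≡0 l)) (ℚ.*-zeroˡ ((x^ e (suc l)) m)))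

lacunary-head : ∀ e b → Expanding e → lacunary e b ≈ b 1 · x^ (e 1) ⊕ lacunary (e ∘ suc) (b ∘ suc)
lacunary-head e b e≥ m = ∑₀-extend (λ l → b (suc l) *ℚ (x^ e (suc l)) m) (ℕ.n≤1+n m)
  (λ l m≤l → ·x^-summable e b e≥ (suc l) m (s≤s m≤l))

x^-⊛-lacunary : ∀ d e b → Expanding e → x^ d ⊛ lacunary e b ≈ lacunary (λ l → d + e l) b
x^-⊛-lacunary d e b e≥ = ≈-trans (⊛-distribˡ-∑≥ 1 (x^ d) (λ l → b l · x^ (e l)) (·x^-summable e b e≥))
  (∑≥-cong 1 (λ l _ → ≈-trans (⊛-·ʳ (b l) (x^ d) (x^ (e l))) (·-congˡ (b l) (x^-⊛-x^ d (e l)))))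

-- Multiplication by x^d moves each exponent to the next one, so equal exponents pair up and only
-- the first term stays alone. The step is required from index 1 on because `odd 0` is 0 and does
-- not continue the progression 1, 3, 5, ....
telescope : ∀ δ d e b → Expanding e → (∀ l → e (suc (suc l)) ≡ d + e (suc l)) →
  (𝟙 ⊖ δ · x^ d) ⊛ lacunary e b ≈ b 1 · x^ (e 1) ⊕ lacunary (e ∘ suc) (λ l → b (suc l) -ℚ δ *ℚ b l)
telescope δ d e b e≥ e-step m = begin
  ((𝟙 ⊖ δ · x^ d) ⊛ lacunary e b) m
    ≡⟨ ⊖·-⊛ 𝟙 δ (x^ d) (lacunary e b) m ⟩
  (𝟙 ⊛ lacunary e b) m -ℚ δ *ℚ (x^ d ⊛ lacunary e b) m
    ≡⟨ cong₂ (λ f g → f -ℚ δ *ℚ g) (trans (⊛-identityˡ (lacunary e b) m) (lacunary-head e b e≥ m))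
         (trans (x^-⊛-lacunary d e b e≥ m) (lacunary-cong (λ l → d + e l) (e ∘ suc) b b (λ l → sym (e-step l)) (λ _ → refl) m)) ⟩
  (b 1 *ℚ (x^ e 1) m +ℚ S₁) -ℚ δ *ℚ S₂
    ≡⟨ solve 4 (λ a S₁ S₂ δ → (a :+ S₁) :- δ :* S₂ := a :+ (S₁ :+ (:- δ) :* S₂)) refl (b 1 *ℚ (x^ e 1) m) S₁ S₂ δ ⟩
  b 1 *ℚ (x^ e 1) m +ℚ (S₁ +ℚ (ℚ.- δ) *ℚ S₂)
    ≡⟨ cong (b 1 *ℚ (x^ e 1) m +ℚ_) (begin
         S₁ +ℚ (ℚ.- δ) *ℚ S₂
           ≡⟨ cong (S₁ +ℚ_) (*-distribˡ-∑₀ m (ℚ.- δ) (λ l → b (suc l) *ℚ (x^ e (suc (suc l))) m)) ⟩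
         S₁ +ℚ ∑₀ m (λ l → (ℚ.- δ) *ℚ (b (suc l) *ℚ (x^ e (suc (suc l))) m))
           ≡⟨ ∑₀-distrib-+ m (λ l → b (suc (suc l)) *ℚ (x^ e (suc (suc l))) m) (λ l → (ℚ.- δ) *ℚ (b (suc l) *ℚ (x^ e (suc (suc l))) m)) ⟨
         ∑₀ m (λ l → b (suc (suc l)) *ℚ (x^ e (suc (suc l))) m +ℚ (ℚ.- δ) *ℚ (b (suc l) *ℚ (x^ e (suc (suc l))) m))
           ≡⟨ ∑₀-cong m (λ l _ → solve 4 (λ a b δ x → a :* x :+ (:- δ) :* (b :* x) := (a :- δ :* b) :* x) refl
                (b (suc (suc l))) (b (suc l)) δ ((x^ e (suc (suc l))) m)) ⟩
         lacunary (e ∘ suc) (λ l → b (suc l) -ℚ δ *ℚ b l) m ∎) ⟩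
  b 1 *ℚ (x^ e 1) m +ℚ lacunary (e ∘ suc) (λ l → b (suc l) -ℚ δ *ℚ b l) m ∎
  where
  S₁ S₂ : ℚ
  S₁ = lacunary (e ∘ suc) (b ∘ suc) m
  S₂ = lacunary (e ∘ suc) b m

-- δ^(l-1), meant for l ≥ 1.
sign : ℚ → ℕ → ℚ
sign δ l = δ ^ℚ (l ∸ 1)

-- The coefficients δ^(l-1) are the ones whose twisted differences all vanish, so the head term
-- alone survives.
geometric : ∀ δ d e → Expanding e → (∀ l → e (suc (suc l)) ≡ d + e (suc l)) → 1 ≤ d →
  x^ (e 1) ⊘ (𝟙 ⊖ δ · x^ d) ≈ lacunary e (sign δ)
-- For a successor `d` the coefficient `(x^ d) 0` computes to `0ℚ`, which gives the constant term 1.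
geometric δ d@(suc _) e e≥ e-step _ = ≈-trans (λ m → sym (ℚ.*-identityˡ ((x^ e 1 ⊘ (𝟙 ⊖ δ · x^ d)) m))) (⊛-cancel-⊘ 1ℚ (x^ e 1) (𝟙 ⊖ δ · x^ d) (lacunary e (sign δ)) one-constant (λ m → begin
  ((𝟙 ⊖ δ · x^ d) ⊛ lacunary e (sign δ)) m
    ≡⟨ telescope δ d e (sign δ) e≥ e-step m ⟩
  1ℚ *ℚ (x^ e 1) m +ℚ lacunary (e ∘ suc) (λ l → sign δ (suc l) -ℚ δ *ℚ sign δ l) m
    ≡⟨ cong (1ℚ *ℚ (x^ e 1) m +ℚ_) (lacunary-zero (e ∘ suc) (λ l → sign δ (suc l) -ℚ δ *ℚ sign δ l) (λ l → ℚ.+-inverseʳ (δ ^ℚ suc l)) m) ⟩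
  1ℚ *ℚ (x^ e 1) m +ℚ 0ℚ
    ≡⟨ ℚ.+-identityʳ (1ℚ *ℚ (x^ e 1) m) ⟩
  1ℚ *ℚ (x^ e 1) m ∎))
  where
  one-constant : (𝟙 ⊖ δ · x^ d) 0 ≡ 1ℚ
  one-constant = solve 1 (λ δ → con 1ℚ :- δ :* con 0ℚ := con 1ℚ) refl δ

2*suc∸1 : ∀ j → 2 * suc j ∸ 1 ≡ suc (2 * j)
2*suc∸1 j = cong (_∸ 1) (ℕ.*-suc 2 j)

double odd : ℕ → ℕ
double n = 2 * n
odd n = 2 * n ∸ 1

double-expanding : Expanding double
double-expanding n = ℕ.m≤m+n n (n + 0)

odd-expanding : Expanding odd
odd-expanding zero    = z≤n
odd-expanding (suc j) = subst (suc j ≤_) (sym (2*suc∸1 j)) (s≤s (double-expanding j))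

*-expanding : ∀ u v → 1 ≤ u → Expanding v → Expanding (λ l → u * v l)
*-expanding (suc k) v _ v≥ l = ℕ.≤-trans (v≥ l) (ℕ.m≤m+n (v l) (k * v l))

-- Odd and even multiples of u interleave at distance u. This distance is the factor x^u left over
-- when `f` turns `Even` into `Odd` or `Odd` into `Even`. By computation, `double (suc l)` is
-- `suc (odd (suc l))`.
u*double : ∀ u l → u * double (suc l) ≡ u + u * odd (suc l)
u*double u l = ℕ.*-suc u (odd (suc l))

u*odd : ∀ u l → u * odd (suc (suc l)) ≡ u + u * double (suc l)
u*odd u l = trans (cong (u *_) (2*suc∸1 (suc l))) (ℕ.*-suc u (double (suc l)))

u*double-step : ∀ u l → u * double (suc (suc l)) ≡ 2 * u + u * double (suc l)
u*double-step u l = trans (u*double u (suc l)) (trans (cong (_+_ u) (u*odd u l))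
  (trans (sym (ℕ.+-assoc u u _)) (cong (λ v → u + v + u * double (suc l)) (sym (ℕ.+-identityʳ u)))))

u*odd-step : ∀ u l → u * odd (suc (suc l)) ≡ 2 * u + u * odd (suc l)
u*odd-step u l = trans (u*odd u l) (trans (cong (_+_ u) (u*double u l))
  (trans (sym (ℕ.+-assoc u u _)) (cong (λ v → u + v + u * odd (suc l)) (sym (ℕ.+-identityʳ u)))))

-- Powers of y/(1 - δ y²) for y = x^u

module PowerExpansion (δ : ℚ) (u : ℕ) (1≤u : 1 ≤ u) where

  f : Series
  f = 𝟙 ⊖ δ · x^ (2 * u)

  Even Odd : ℕ → Series
  Even t = lacunary (λ l → u * double l) (λ l → sign δ l *ℚ Φ t (fromℕ l))
  Odd  t = lacunary (λ l → u * odd l)    (λ l → sign δ l *ℚ Ψ t (fromℕ l))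

  f-constant : f 0 ≡ 1ℚ
  f-constant = trans (cong (λ a → 1ℚ -ℚ δ *ℚ a) (x^-vanish {2 * u} (ℕ.≤-trans 1≤u (double-expanding u))))
    (solve 1 (λ δ → con 1ℚ :- δ :* con 0ℚ := con 1ℚ) refl δ)

  f⊛Even : ∀ t → f ⊛ Even t ≈ fromℕ (suc (2 * t)) · (x^ u ⊛ Odd t)
  f⊛Even t m = begin
    (f ⊛ Even t) m
      ≡⟨ telescope δ (2 * u) e b e-expanding (u*double-step u) m ⟩
    b 1 *ℚ (x^ e 1) m +ℚ lacunary (e ∘ suc) (λ l → b (suc l) -ℚ δ *ℚ b l) m
      ≡⟨ cong₂ (λ a S → a *ℚ (x^ e 1) m +ℚ S) first (lacunary-cong (e ∘ suc) (e ∘ suc) (λ l → b (suc l) -ℚ δ *ℚ b l) (λ l → c (suc l)) (λ _ → refl) next m) ⟩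
    c 1 *ℚ (x^ e 1) m +ℚ lacunary (e ∘ suc) (λ l → c (suc l)) m
      ≡⟨ lacunary-head e c e-expanding m ⟨
    lacunary e c m
      ≡⟨ lacunary-cong e (λ l → u + u * odd l) c c (u*double u) (λ _ → refl) m ⟩
    lacunary (λ l → u + u * odd l) c m
      ≡⟨ lacunary-· κ (λ l → u + u * odd l) (λ l → sign δ l *ℚ Ψ t (fromℕ l)) m ⟩
    κ *ℚ lacunary (λ l → u + u * odd l) (λ l → sign δ l *ℚ Ψ t (fromℕ l)) m
      ≡⟨ cong (κ *ℚ_) (x^-⊛-lacunary u (λ l → u * odd l) (λ l → sign δ l *ℚ Ψ t (fromℕ l)) (*-expanding u odd 1≤u odd-expanding) m) ⟨
    κ *ℚ (x^ u ⊛ Odd t) m ∎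
    where
    κ : ℚ
    κ = fromℕ (suc (2 * t))
    e : ℕ → ℕ
    e l = u * double l
    e-expanding : Expanding e
    e-expanding = *-expanding u double 1≤u double-expanding
    b c : ℕ → ℚ
    b l = sign δ l *ℚ Φ t (fromℕ l)
    c l = κ *ℚ (sign δ l *ℚ Ψ t (fromℕ l))
    -- The head term has no predecessor to subtract, but `Φ t 0` vanishes and can stand in for one.
    first : b 1 ≡ c 1
    first = begin
      1ℚ *ℚ Φ t (fromℕ 1)
        ≡⟨ solve 1 (λ a → con 1ℚ :* a := a :- con 0ℚ) refl (Φ t (fromℕ 1)) ⟩
      Φ t (fromℕ 1) -ℚ 0ℚ
        ≡⟨ cong (Φ t (fromℕ 1) -ℚ_) (Φ-zero t) ⟨
      Φ t (fromℕ 1) -ℚ Φ t (fromℕ 0)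
        ≡⟨ Φ-difference t 0 ⟩
      κ *ℚ Ψ t (fromℕ 1)
        ≡⟨ cong (κ *ℚ_) (ℚ.*-identityˡ (Ψ t (fromℕ 1))) ⟨
      c 1 ∎
    next : ∀ l → b (suc (suc l)) -ℚ δ *ℚ b (suc l) ≡ c (suc (suc l))
    next l = begin
      (δ *ℚ δ ^ℚ l) *ℚ Φ t (fromℕ (suc (suc l))) -ℚ δ *ℚ (δ ^ℚ l *ℚ Φ t (fromℕ (suc l)))
        ≡⟨ solve 4 (λ δ d a b → (δ :* d) :* a :- δ :* (d :* b) := (δ :* d) :* (a :- b)) refl
             δ (δ ^ℚ l) (Φ t (fromℕ (suc (suc l)))) (Φ t (fromℕ (suc l))) ⟩
      (δ *ℚ δ ^ℚ l) *ℚ (Φ t (fromℕ (suc (suc l))) -ℚ Φ t (fromℕ (suc l)))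
        ≡⟨ cong ((δ *ℚ δ ^ℚ l) *ℚ_) (Φ-difference t (suc l)) ⟩
      (δ *ℚ δ ^ℚ l) *ℚ (κ *ℚ Ψ t (fromℕ (suc (suc l))))
        ≡⟨ solve 3 (λ d k p → d :* (k :* p) := k :* (d :* p)) refl (δ *ℚ δ ^ℚ l) κ (Ψ t (fromℕ (suc (suc l)))) ⟩
      c (suc (suc l)) ∎

  -- The head term vanishes and the remaining sum starts one index later. Re-indexing it costs a
  -- factor δ; these factors accumulate to the δ^t of `oddCoeff` and `evenCoeff`.
  f⊛Odd[1+t] : ∀ t → f ⊛ Odd (suc t) ≈ (fromℕ (suc (suc (2 * t))) *ℚ δ) · (x^ u ⊛ Even t)
  f⊛Odd[1+t] t m = begin
    (f ⊛ Odd (suc t)) m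
      ≡⟨ telescope δ (2 * u) e b (*-expanding u odd 1≤u odd-expanding) (u*odd-step u) m ⟩
    b 1 *ℚ (x^ e 1) m +ℚ lacunary (e ∘ suc) (λ l → b (suc l) -ℚ δ *ℚ b l) m
      ≡⟨ cong₂ _+ℚ_ (trans (cong (_*ℚ (x^ e 1) m) (trans (ℚ.*-identityˡ (Ψ (suc t) 1ℚ)) (Ψ[1+t]-one t))) (ℚ.*-zeroˡ ((x^ e 1) m)))
           (lacunary-cong (e ∘ suc) (λ l → u + u * double l) (λ l → b (suc l) -ℚ δ *ℚ b l) c (u*odd u) next m) ⟩
    0ℚ +ℚ lacunary (λ l → u + u * double l) c m
      ≡⟨ ℚ.+-identityˡ (lacunary (λ l → u + u * double l) c m) ⟩
    lacunary (λ l → u + u * double l) c m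
      ≡⟨ lacunary-· κ (λ l → u + u * double l) (λ l → sign δ l *ℚ Φ t (fromℕ l)) m ⟩
    κ *ℚ lacunary (λ l → u + u * double l) (λ l → sign δ l *ℚ Φ t (fromℕ l)) m
      ≡⟨ cong (κ *ℚ_) (x^-⊛-lacunary u (λ l → u * double l) (λ l → sign δ l *ℚ Φ t (fromℕ l)) (*-expanding u double 1≤u double-expanding) m) ⟨
    κ *ℚ (x^ u ⊛ Even t) m ∎
    where
    κ : ℚ
    κ = fromℕ (suc (suc (2 * t))) *ℚ δ
    e : ℕ → ℕ
    e l = u * odd l
    b c : ℕ → ℚ
    b l = sign δ l *ℚ Ψ (suc t) (fromℕ l)
    c l = κ *ℚ (sign δ l *ℚ Φ t (fromℕ l))
    next : ∀ l → b (suc (suc l)) -ℚ δ *ℚ b (suc l) ≡ c (suc l)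
    next l = begin
      (δ *ℚ δ ^ℚ l) *ℚ Ψ (suc t) (fromℕ (suc (suc l))) -ℚ δ *ℚ (δ ^ℚ l *ℚ Ψ (suc t) (fromℕ (suc l)))
        ≡⟨ solve 4 (λ δ d a b → (δ :* d) :* a :- δ :* (d :* b) := (δ :* d) :* (a :- b)) refl
             δ (δ ^ℚ l) (Ψ (suc t) (fromℕ (suc (suc l)))) (Ψ (suc t) (fromℕ (suc l))) ⟩
      (δ *ℚ δ ^ℚ l) *ℚ (Ψ (suc t) (fromℕ (suc (suc l))) -ℚ Ψ (suc t) (fromℕ (suc l)))
        ≡⟨ cong ((δ *ℚ δ ^ℚ l) *ℚ_) (Ψ-difference t (suc l)) ⟩
      (δ *ℚ δ ^ℚ l) *ℚ (fromℕ (suc (suc (2 * t))) *ℚ Φ t (fromℕ (suc l)))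
        ≡⟨ solve 4 (λ δ d k p → (δ :* d) :* (k :* p) := (k :* δ) :* (d :* p)) refl
             δ (δ ^ℚ l) (fromℕ (suc (suc (2 * t)))) (Φ t (fromℕ (suc l))) ⟩
      c (suc l) ∎

  -- `Ψ 0` is constant, so `Odd 0` is a geometric series. The right-hand side is written with `𝟙` to
  -- give `⊛^-step` its starting point.
  f⊛Odd[0] : f ⊛ Odd 0 ≈ 1ℚ · (x^ u ⊛ 𝟙)
  f⊛Odd[0] m = begin
    (f ⊛ Odd 0) m
      ≡⟨ telescope δ (2 * u) e b (*-expanding u odd 1≤u odd-expanding) (u*odd-step u) m ⟩
    1ℚ *ℚ (x^ e 1) m +ℚ lacunary (e ∘ suc) (λ l → b (suc l) -ℚ δ *ℚ b l) m
      ≡⟨ cong (1ℚ *ℚ (x^ e 1) m +ℚ_) (lacunary-zero (e ∘ suc) (λ l → b (suc l) -ℚ δ *ℚ b l) (λ l →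
           solve 2 (λ δ d → (δ :* d) :* con 1ℚ :- δ :* (d :* con 1ℚ) := con 0ℚ) refl δ (δ ^ℚ l)) m) ⟩
    1ℚ *ℚ (x^ e 1) m +ℚ 0ℚ
      ≡⟨ ℚ.+-identityʳ (1ℚ *ℚ (x^ e 1) m) ⟩
    1ℚ *ℚ (x^ e 1) m
      ≡⟨ cong (1ℚ *ℚ_) (trans (cong (λ k → (x^ k) m) (ℕ.*-identityʳ u)) (sym (⊛-identityʳ (x^ u) m))) ⟩
    1ℚ *ℚ (x^ u ⊛ 𝟙) m ∎
    where
    e : ℕ → ℕ
    e l = u * odd l
    b : ℕ → ℚ
    b l = sign δ l *ℚ 1ℚ

  ⊛^-step : ∀ k c d g h → f ⊛ g ≈ c · (x^ u ⊛ h) → f ⊛^ k ⊛ h ≈ d · x^ (u * k) →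
            f ⊛^ suc k ⊛ g ≈ (c *ℚ d) · x^ (u * suc k)
  ⊛^-step k c d g h fg fᵏh m = begin
    ((f ⊛ f ⊛^ k) ⊛ g) m
      ≡⟨ ⊛-congʳ g (⊛-comm f (f ⊛^ k)) m ⟩
    ((f ⊛^ k ⊛ f) ⊛ g) m
      ≡⟨ ⊛-assoc (f ⊛^ k) f g m ⟩
    (f ⊛^ k ⊛ (f ⊛ g)) m
      ≡⟨ ⊛-congˡ (f ⊛^ k) fg m ⟩
    (f ⊛^ k ⊛ (c · (x^ u ⊛ h))) m
      ≡⟨ ⊛-·ʳ c (f ⊛^ k) (x^ u ⊛ h) m ⟩
    c *ℚ (f ⊛^ k ⊛ (x^ u ⊛ h)) m
      ≡⟨ cong (c *ℚ_) (⊛-assoc (f ⊛^ k) (x^ u) h m) ⟨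
    c *ℚ ((f ⊛^ k ⊛ x^ u) ⊛ h) m
      ≡⟨ cong (c *ℚ_) (⊛-congʳ h (⊛-comm (f ⊛^ k) (x^ u)) m) ⟩
    c *ℚ ((x^ u ⊛ f ⊛^ k) ⊛ h) m
      ≡⟨ cong (c *ℚ_) (⊛-assoc (x^ u) (f ⊛^ k) h m) ⟩
    c *ℚ (x^ u ⊛ (f ⊛^ k ⊛ h)) m
      ≡⟨ cong (c *ℚ_) (⊛-congˡ (x^ u) fᵏh m) ⟩
    c *ℚ (x^ u ⊛ (d · x^ (u * k))) m
      ≡⟨ cong (c *ℚ_) (⊛-·ʳ d (x^ u) (x^ (u * k)) m) ⟩
    c *ℚ (d *ℚ (x^ u ⊛ x^ (u * k)) m)
      ≡⟨ cong (λ a → c *ℚ (d *ℚ a)) (trans (x^-⊛-x^ u (u * k) m) (cong (λ e → (x^ e) m) (sym (ℕ.*-suc u k)))) ⟩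
    c *ℚ (d *ℚ (x^ (u * suc k)) m)
      ≡⟨ ℚ.*-assoc c d ((x^ (u * suc k)) m) ⟨
    (c *ℚ d) *ℚ (x^ (u * suc k)) m ∎

  oddCoeff evenCoeff : ℕ → ℚ
  oddCoeff  t = fromℕ ((2 * t) !) *ℚ δ ^ℚ t
  evenCoeff t = fromℕ (suc (2 * t) !) *ℚ δ ^ℚ t

  -- A joint induction along `Odd 0`, `Even 0`, `Odd 1`, `Even 1`, ...: every step uses up one more
  -- factor `f` and multiplies the factorial by its next factor.
  odd-power  : ∀ t → f ⊛^ suc (2 * t) ⊛ Odd t ≈ oddCoeff t · x^ (u * suc (2 * t))
  even-power : ∀ t → f ⊛^ suc (suc (2 * t)) ⊛ Even t ≈ evenCoeff t · x^ (u * suc (suc (2 * t)))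

  odd-power zero = ⊛^-step 0 1ℚ 1ℚ (Odd 0) 𝟙 f⊛Odd[0] (λ m → trans (⊛-identityˡ 𝟙 m)
    (trans (cong (λ k → (x^ k) m) (sym (ℕ.*-zeroʳ u))) (sym (ℚ.*-identityˡ ((x^ (u * 0)) m)))))
  odd-power (suc t) = subst₂ (λ k c → f ⊛^ suc k ⊛ Odd (suc t) ≈ c · x^ (u * suc k)) (sym (ℕ.*-suc 2 t)) coeff
    (⊛^-step (suc (suc (2 * t))) (fromℕ (suc (suc (2 * t))) *ℚ δ) (evenCoeff t) (Odd (suc t)) (Even t) (f⊛Odd[1+t] t) (even-power t))
    where
    coeff : (fromℕ (suc (suc (2 * t))) *ℚ δ) *ℚ evenCoeff t ≡ oddCoeff (suc t)
    coeff = begin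
      (fromℕ (suc (suc (2 * t))) *ℚ δ) *ℚ (fromℕ (suc (2 * t) !) *ℚ δ ^ℚ t)
        ≡⟨ solve 4 (λ a b c d → (a :* b) :* (c :* d) := (a :* c) :* (b :* d)) refl
             (fromℕ (suc (suc (2 * t)))) δ (fromℕ (suc (2 * t) !)) (δ ^ℚ t) ⟩
      (fromℕ (suc (suc (2 * t))) *ℚ fromℕ (suc (2 * t) !)) *ℚ δ ^ℚ suc t
        ≡⟨ cong (_*ℚ δ ^ℚ suc t) (fromℕ-homo-* (suc (suc (2 * t))) (suc (2 * t) !)) ⟨
      fromℕ (suc (suc (2 * t)) !) *ℚ δ ^ℚ suc t
        ≡⟨ cong (λ k → fromℕ (k !) *ℚ δ ^ℚ suc t) (ℕ.*-suc 2 t) ⟨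
      oddCoeff (suc t) ∎

  even-power t m = trans (⊛^-step (suc (2 * t)) (fromℕ (suc (2 * t))) (oddCoeff t) (Even t) (Odd t) (f⊛Even t) (odd-power t) m) (cong (_*ℚ (x^ (u * suc (suc (2 * t)))) m) (begin
    fromℕ (suc (2 * t)) *ℚ (fromℕ ((2 * t) !) *ℚ δ ^ℚ t)
      ≡⟨ ℚ.*-assoc (fromℕ (suc (2 * t))) (fromℕ ((2 * t) !)) (δ ^ℚ t) ⟨
    fromℕ (suc (2 * t)) *ℚ fromℕ ((2 * t) !) *ℚ δ ^ℚ t
      ≡⟨ cong (_*ℚ δ ^ℚ t) (fromℕ-homo-* (suc (2 * t)) ((2 * t) !)) ⟨
    evenCoeff t ∎))

  odd-expansion : ∀ t → oddCoeff t · (x^ (u * suc (2 * t)) ⊘ f ⊛^ suc (2 * t)) ≈ Odd t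
  odd-expansion t = ⊛-cancel-⊘ (oddCoeff t) (x^ (u * suc (2 * t))) (f ⊛^ suc (2 * t)) (Odd t)
    (⊛^-constant f f-constant (suc (2 * t))) (odd-power t)

  even-expansion : ∀ t → evenCoeff t · (x^ (u * suc (suc (2 * t))) ⊘ f ⊛^ suc (suc (2 * t))) ≈ Even t
  even-expansion t = ⊛-cancel-⊘ (evenCoeff t) (x^ (u * suc (suc (2 * t)))) (f ⊛^ suc (suc (2 * t))) (Even t)
    (⊛^-constant f f-constant (suc (suc (2 * t)))) (even-power t)

-- Double series Σ aₙ bₗ x^(u(n) v(l))

doubleSeries : (u v : ℕ → ℕ) (a b : ℕ → ℚ) → Series
doubleSeries u v a b = ∑[ n ≥ 1 ] a n · lacunary (λ l → u n * v l) b

module _ (u v : ℕ → ℕ) where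

  doubleSeries-cong : ∀ a a′ b b′ → (∀ n → a (suc n) ≡ a′ (suc n)) → (∀ l → b (suc l) ≡ b′ (suc l)) →
                      doubleSeries u v a b ≈ doubleSeries u v a′ b′
  doubleSeries-cong a a′ b b′ a≡a′ b≡b′ m = ∑₀-cong m (λ n _ → cong₂ _*ℚ_ (a≡a′ n)
    (lacunary-cong (λ l → u (suc n) * v l) (λ l → u (suc n) * v l) b b′ (λ _ → refl) b≡b′ m))

  -- Both sums are cut off at the same m, so the exchange of n and l is an exchange of finite sums.
  doubleSeries-swap : ∀ a b → doubleSeries u v a b ≈ doubleSeries v u b a
  doubleSeries-swap a b m = begin
    ∑₀ m (λ n → a (suc n) *ℚ ∑₀ m (λ l → b (suc l) *ℚ (x^ (u (suc n) * v (suc l))) m))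
      ≡⟨ ∑₀-cong m (λ n _ → *-distribˡ-∑₀ m (a (suc n)) (λ l → b (suc l) *ℚ (x^ (u (suc n) * v (suc l))) m)) ⟩
    ∑₀ m (λ n → ∑₀ m (λ l → a (suc n) *ℚ (b (suc l) *ℚ (x^ (u (suc n) * v (suc l))) m)))
      ≡⟨ ∑₀-comm m m (λ n l → a (suc n) *ℚ (b (suc l) *ℚ (x^ (u (suc n) * v (suc l))) m)) ⟩
    ∑₀ m (λ l → ∑₀ m (λ n → a (suc n) *ℚ (b (suc l) *ℚ (x^ (u (suc n) * v (suc l))) m)))
      ≡⟨ ∑₀-cong m (λ l _ → ∑₀-cong m (λ n _ → trans
           (solve 3 (λ a b x → a :* (b :* x) := b :* (a :* x)) refl (a (suc n)) (b (suc l)) ((x^ (u (suc n) * v (suc l))) m))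
           (cong (λ k → b (suc l) *ℚ (a (suc n) *ℚ (x^ k) m)) (ℕ.*-comm (u (suc n)) (v (suc l)))))) ⟩
    ∑₀ m (λ l → ∑₀ m (λ n → b (suc l) *ℚ (a (suc n) *ℚ (x^ (v (suc l) * u (suc n))) m)))
      ≡⟨ ∑₀-cong m (λ l _ → *-distribˡ-∑₀ m (b (suc l)) (λ n → a (suc n) *ℚ (x^ (v (suc l) * u (suc n))) m)) ⟨
    doubleSeries v u b a m ∎

-- Both sides vanish unless m = k. Thus 𝐃, defined through the coefficient index, multiplies x^k by
-- k/2.
x^-weight : (g : ℕ → ℚ) → ∀ k m → g m *ℚ (x^ k) m ≡ g k *ℚ (x^ k) m
x^-weight g zero    zero    = refl
x^-weight g zero    (suc m) = trans (ℚ.*-zeroʳ (g (suc m))) (sym (ℚ.*-zeroʳ (g 0)))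
x^-weight g (suc k) zero    = trans (ℚ.*-zeroʳ (g 0)) (sym (ℚ.*-zeroʳ (g (suc k))))
x^-weight g (suc k) (suc m) = x^-weight (g ∘ suc) k m

module _ (u v : ℕ → ℕ) where

  -- The swap brings the combination from the inner coefficients to the outer ones, where a single
  -- exchange of finite sums suffices.
  doubleSeries-∑ : ∀ k (t : ℕ → ℚ) a (B : ℕ → ℕ → ℚ) m →
    doubleSeries u v a (λ l → ∑₀ k (λ r → t r *ℚ B r l)) m ≡ ∑₀ k (λ r → t r *ℚ doubleSeries u v a (B r) m)
  doubleSeries-∑ k t a B m = begin
    doubleSeries u v a (λ l → ∑₀ k (λ r → t r *ℚ B r l)) m
      ≡⟨ doubleSeries-swap u v a (λ l → ∑₀ k (λ r → t r *ℚ B r l)) m ⟩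
    ∑₀ m (λ l → ∑₀ k (λ r → t r *ℚ B r (suc l)) *ℚ K l)
      ≡⟨ ∑₀-cong m (λ l _ → trans (ℚ.*-comm (∑₀ k (λ r → t r *ℚ B r (suc l))) (K l)) (*-distribˡ-∑₀ k (K l) (λ r → t r *ℚ B r (suc l)))) ⟩
    ∑₀ m (λ l → ∑₀ k (λ r → K l *ℚ (t r *ℚ B r (suc l))))
      ≡⟨ ∑₀-comm m k (λ l r → K l *ℚ (t r *ℚ B r (suc l))) ⟩
    ∑₀ k (λ r → ∑₀ m (λ l → K l *ℚ (t r *ℚ B r (suc l))))
      ≡⟨ ∑₀-cong k (λ r _ → trans
           (∑₀-cong m (λ l _ → solve 3 (λ a b c → a :* (b :* c) := b :* (c :* a)) refl (K l) (t r) (B r (suc l))))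
           (sym (*-distribˡ-∑₀ m (t r) (λ l → B r (suc l) *ℚ K l)))) ⟩
    ∑₀ k (λ r → t r *ℚ doubleSeries v u (B r) a m)
      ≡⟨ ∑₀-cong k (λ r _ → cong (t r *ℚ_) (doubleSeries-swap u v a (B r) m)) ⟨
    ∑₀ k (λ r → t r *ℚ doubleSeries u v a (B r) m) ∎
    where
    K : ℕ → ℚ
    K l = lacunary (λ n → v (suc l) * u n) a m

  doubleSeries-· : ∀ c a b → doubleSeries u v a (λ l → c *ℚ b l) ≈ c · doubleSeries u v a b
  doubleSeries-· c a b m = trans
    (∑₀-cong m (λ n _ → trans (cong (a (suc n) *ℚ_) (lacunary-· c (λ l → u (suc n) * v l) b m))
      (solve 3 (λ a c s → a :* (c :* s) := c :* (a :* s)) refl (a (suc n)) c (lacunary (λ l → u (suc n) * v l) b m))))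
    (sym (*-distribˡ-∑₀ m c (λ n → a (suc n) *ℚ lacunary (λ l → u (suc n) * v l) b m)))

  -- x^(u(n) v(l)) is an eigenvector of 𝐃 with eigenvalue u(n) v(l)/2. The condition splits this
  -- number into a factor for n and one for l, and thereby decides which of them receives the ½.
  Eigen : (w w′ : ℕ → ℚ) → Set
  Eigen w w′ = ∀ n l → ½ *ℚ fromℕ (u (suc n) * v (suc l)) ≡ w (suc n) *ℚ w′ (suc l)

  𝐃-doubleSeries : ∀ w w′ → Eigen w w′ → ∀ a b →
    𝐃 (doubleSeries u v a b) ≈ doubleSeries u v (λ n → a n *ℚ w n) (λ l → b l *ℚ w′ l)
  𝐃-doubleSeries w w′ eigen a b m = trans
    (*-distribˡ-∑₀ m (+ m ℚ./ 2) (λ n → a (suc n) *ℚ lacunary (λ l → u (suc n) * v l) b m))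
    (∑₀-cong m (λ n _ → begin
      (+ m ℚ./ 2) *ℚ (a (suc n) *ℚ lacunary (λ l → u (suc n) * v l) b m)
        ≡⟨ solve 3 (λ a c s → a :* (c :* s) := c :* (a :* s)) refl (+ m ℚ./ 2) (a (suc n)) (lacunary (λ l → u (suc n) * v l) b m) ⟩
      a (suc n) *ℚ ((+ m ℚ./ 2) *ℚ lacunary (λ l → u (suc n) * v l) b m)
        ≡⟨ cong (a (suc n) *ℚ_) (begin
             (+ m ℚ./ 2) *ℚ lacunary (λ l → u (suc n) * v l) b m
               ≡⟨ *-distribˡ-∑₀ m (+ m ℚ./ 2) (λ l → b (suc l) *ℚ (x^ (u (suc n) * v (suc l))) m) ⟩
             ∑₀ m (λ l → (+ m ℚ./ 2) *ℚ (b (suc l) *ℚ (x^ (u (suc n) * v (suc l))) m))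
               ≡⟨ ∑₀-cong m (λ l _ → term n l) ⟩
             ∑₀ m (λ l → w (suc n) *ℚ ((b (suc l) *ℚ w′ (suc l)) *ℚ (x^ (u (suc n) * v (suc l))) m))
               ≡⟨ *-distribˡ-∑₀ m (w (suc n)) (λ l → (b (suc l) *ℚ w′ (suc l)) *ℚ (x^ (u (suc n) * v (suc l))) m) ⟨
             w (suc n) *ℚ lacunary (λ l → u (suc n) * v l) (λ l → b l *ℚ w′ l) m ∎) ⟩
      a (suc n) *ℚ (w (suc n) *ℚ lacunary (λ l → u (suc n) * v l) (λ l → b l *ℚ w′ l) m)
        ≡⟨ ℚ.*-assoc (a (suc n)) (w (suc n)) (lacunary (λ l → u (suc n) * v l) (λ l → b l *ℚ w′ l) m) ⟨
      (a (suc n) *ℚ w (suc n)) *ℚ lacunary (λ l → u (suc n) * v l) (λ l → b l *ℚ w′ l) m ∎))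
    where
    term : ∀ n l → (+ m ℚ./ 2) *ℚ (b (suc l) *ℚ (x^ (u (suc n) * v (suc l))) m)
                 ≡ w (suc n) *ℚ ((b (suc l) *ℚ w′ (suc l)) *ℚ (x^ (u (suc n) * v (suc l))) m)
    term n l = begin
      (+ m ℚ./ 2) *ℚ (b (suc l) *ℚ X)
        ≡⟨ solve 3 (λ a c s → a :* (c :* s) := c :* (a :* s)) refl (+ m ℚ./ 2) (b (suc l)) X ⟩
      b (suc l) *ℚ ((+ m ℚ./ 2) *ℚ X)
        ≡⟨ cong (b (suc l) *ℚ_) (x^-weight (λ k → + k ℚ./ 2) (u (suc n) * v (suc l)) m) ⟩
      b (suc l) *ℚ ((+ (u (suc n) * v (suc l)) ℚ./ 2) *ℚ X)
        ≡⟨ cong (λ c → b (suc l) *ℚ (c *ℚ X)) (trans (n/2≡½*n (u (suc n) * v (suc l))) (eigen n l)) ⟩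
      b (suc l) *ℚ ((w (suc n) *ℚ w′ (suc l)) *ℚ X)
        ≡⟨ solve 4 (λ b w w′ X → b :* ((w :* w′) :* X) := w :* ((b :* w′) :* X)) refl (b (suc l)) (w (suc n)) (w′ (suc l)) X ⟩
      w (suc n) *ℚ ((b (suc l) *ℚ w′ (suc l)) *ℚ X) ∎
      where
      X : ℚ
      X = (x^ (u (suc n) * v (suc l))) m

  𝐃^-doubleSeries : ∀ w w′ → Eigen w w′ → ∀ k a b →
    𝐃^ k (doubleSeries u v a b) ≈ doubleSeries u v (λ n → a n *ℚ w n ^ℚ k) (λ l → b l *ℚ w′ l ^ℚ k)
  𝐃^-doubleSeries w w′ eigen zero a b = doubleSeries-cong u v a (λ n → a n *ℚ 1ℚ) b (λ l → b l *ℚ 1ℚ)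
    (λ n → sym (ℚ.*-identityʳ (a (suc n)))) (λ l → sym (ℚ.*-identityʳ (b (suc l))))
  𝐃^-doubleSeries w w′ eigen (suc k) a b m = begin
    (+ m ℚ./ 2) *ℚ 𝐃^ k (doubleSeries u v a b) m
      ≡⟨ cong ((+ m ℚ./ 2) *ℚ_) (𝐃^-doubleSeries w w′ eigen k a b m) ⟩
    𝐃 (doubleSeries u v (λ n → a n *ℚ w n ^ℚ k) (λ l → b l *ℚ w′ l ^ℚ k)) m
      ≡⟨ 𝐃-doubleSeries w w′ eigen (λ n → a n *ℚ w n ^ℚ k) (λ l → b l *ℚ w′ l ^ℚ k) m ⟩
    doubleSeries u v (λ n → (a n *ℚ w n ^ℚ k) *ℚ w n) (λ l → (b l *ℚ w′ l ^ℚ k) *ℚ w′ l) m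
      ≡⟨ doubleSeries-cong u v (λ n → (a n *ℚ w n ^ℚ k) *ℚ w n) (λ n → a n *ℚ w n ^ℚ suc k)
           (λ l → (b l *ℚ w′ l ^ℚ k) *ℚ w′ l) (λ l → b l *ℚ w′ l ^ℚ suc k)
           (λ n → power (a (suc n)) (w (suc n))) (λ l → power (b (suc l)) (w′ (suc l))) m ⟩
    doubleSeries u v (λ n → a n *ℚ w n ^ℚ suc k) (λ l → b l *ℚ w′ l ^ℚ suc k) m ∎
    where
    power : ∀ c z → (c *ℚ z ^ℚ k) *ℚ z ≡ c *ℚ (z *ℚ z ^ℚ k)
    power c z = solve 3 (λ c z y → (c :* y) :* z := c :* (z :* y)) refl c z (z ^ℚ k)

𝐃^-cong : ∀ k {f g} → f ≈ g → 𝐃^ k f ≈ 𝐃^ k g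
𝐃^-cong zero    f≈g   = f≈g
𝐃^-cong (suc k) f≈g m = cong ((+ m ℚ./ 2) *ℚ_) (𝐃^-cong k f≈g m)

-- Substitution of q² for q

⟨q²⟩-cong : ∀ {f g} → f ≈ g → f ⟨q²⟩ ≈ g ⟨q²⟩
⟨q²⟩-cong f≈g m with m mod 2 ≡ᵇ 0
... | true  = f≈g (m div 2)
... | false = refl

·-⟨q²⟩ : ∀ c f → (c · f) ⟨q²⟩ ≈ c · f ⟨q²⟩
·-⟨q²⟩ c f m with m mod 2 ≡ᵇ 0
... | true  = refl
... | false = sym (ℚ.*-zeroʳ c)

∑≥-⟨q²⟩ : ∀ a F → Summable F → (∑≥ a F) ⟨q²⟩ ≈ ∑≥ a (λ n → F n ⟨q²⟩)
∑≥-⟨q²⟩ a F F-summable m with m mod 2 ≡ᵇ 0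
... | true  = ∑₀-extend (λ n → F (a + n) (m div 2)) (ℕ.∸-monoˡ-≤ a (s≤s (m/n≤m m 2)))
                (λ n le → F-summable (a + n) (m div 2) (ℕ.≤-trans (ℕ.m≤n+m∸n (suc (m div 2)) a) (ℕ.+-monoʳ-≤ a le)))
... | false = sym (∑₀-zero (suc m ∸ a) (λ _ _ → refl))

-- The induction lowers `k` by one and the coefficient index by two.
x^-⟨q²⟩ : ∀ k → (x^ k) ⟨q²⟩ ≈ x^ (2 * k)
x^-⟨q²⟩ zero zero                = refl
x^-⟨q²⟩ zero (suc zero)          = refl
x^-⟨q²⟩ zero (suc (suc m)) rewrite m/n≡1+[m∸n]/n {suc (suc m)} {2} (s≤s (s≤s z≤n)) with m mod 2 ≡ᵇ 0
... | true  = refl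
... | false = refl
x^-⟨q²⟩ (suc k) zero             = refl
x^-⟨q²⟩ (suc k) (suc zero)       rewrite ℕ.+-suc k (k + 0) = refl
x^-⟨q²⟩ (suc k) (suc (suc m))    rewrite ℕ.+-suc k (k + 0) | m/n≡1+[m∸n]/n {suc (suc m)} {2} (s≤s (s≤s z≤n)) = x^-⟨q²⟩ k m

-- Putting the factor 2 on `v` turns the exponents `double`, `id` of `A`, `B`, `L`, `M` into
-- `double`, `double`, those of the even powers in `I`, `II`, `V`, `VI`.
doubleSeries-⟨q²⟩ : ∀ u v → Expanding u → Expanding v → ∀ a b →
  (doubleSeries u v a b) ⟨q²⟩ ≈ doubleSeries u (λ l → 2 * v l) a b
doubleSeries-⟨q²⟩ u v u≥ v≥ a b = ≈-trans (∑≥-⟨q²⟩ 1 (λ n → a n · lacunary (λ l → u n * v l) b) outer)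
  (∑≥-cong 1 (λ n 1≤n → ≈-trans (·-⟨q²⟩ (a n) (lacunary (λ l → u n * v l) b)) (·-congˡ (a n) (inner n 1≤n))))
  where
  outer : Summable (λ n → a n · lacunary (λ l → u n * v l) b)
  outer n m m<n = trans (cong (a n *ℚ_) (∑₀-zero m (λ l _ → trans (cong (b (suc l) *ℚ_)
      (x^-vanish (ℕ.≤-trans m<n (ℕ.≤-trans (u≥ n) (ℕ.≤-trans (ℕ.≤-reflexive (sym (ℕ.*-identityʳ (u n))))
        (ℕ.*-monoʳ-≤ (u n) (ℕ.≤-trans (s≤s z≤n) (v≥ (suc l)))))))))
      (ℚ.*-zeroʳ (b (suc l)))))) (ℚ.*-zeroʳ (a n))
  inner : ∀ n → 1 ≤ n → (lacunary (λ l → u n * v l) b) ⟨q²⟩ ≈ lacunary (λ l → u n * (2 * v l)) b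
  inner n 1≤n = ≈-trans
    (∑≥-⟨q²⟩ 1 (λ l → b l · x^ (u n * v l)) (·x^-summable (λ l → u n * v l) b (*-expanding (u n) v (ℕ.≤-trans 1≤n (u≥ n)) v≥)))
    (∑≥-cong 1 (λ l _ → ≈-trans (·-⟨q²⟩ (b l) (x^ (u n * v l))) (·-congˡ (b l) (λ m → trans (x^-⟨q²⟩ (u n * v l) m)
      (cong (λ k → (x^ k) m) (trans (sym (ℕ.*-assoc 2 (u n) (v l)))
        (trans (cong (_* v l) (ℕ.*-comm 2 (u n))) (ℕ.*-assoc (u n) 2 (v l)))))))))

-- Recombination of the two ranges of summation

∑<-coeff : ∀ a b F m → (∑< a b F) m ≡ ∑ℚ a b (λ r → F r m)
∑<-coeff a b F m = go (b ∸ a) (λ i → F (a + i))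
  where
  go : ∀ n (G : ℕ → Series) → (∑< 0 n G) m ≡ ∑₀ n (λ i → G i m)
  go zero    G = refl
  go (suc n) G = cong (G 0 m +ℚ_) (go n (G ∘ suc))

∑ℚ-split : ∀ a c s (g : ℕ → ℚ) → a ≤ c → (∀ r → s < r → g r ≡ 0ℚ) →
           ∑ℚ a (suc s) g ≡ ∑ℚ a c g +ℚ ∑ℚ c (suc s) g
∑ℚ-split a c s g a≤c g-vanish with ℕ.≤-total c (suc s)
... | inj₁ c≤1+s = begin
  ∑₀ (suc s ∸ a) (λ i → g (a + i))
    ≡⟨ cong (λ k → ∑₀ k (λ i → g (a + i))) lengths ⟨
  ∑₀ ((c ∸ a) + (suc s ∸ c)) (λ i → g (a + i))
    ≡⟨ ∑₀-++ (c ∸ a) (suc s ∸ c) (λ i → g (a + i)) ⟩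
  ∑ℚ a c g +ℚ ∑₀ (suc s ∸ c) (λ i → g (a + ((c ∸ a) + i)))
    ≡⟨ cong (∑ℚ a c g +ℚ_) (∑₀-cong (suc s ∸ c) (λ i _ → cong g
         (trans (sym (ℕ.+-assoc a (c ∸ a) i)) (cong (_+ i) (ℕ.m+[n∸m]≡n a≤c))))) ⟩
  ∑ℚ a c g +ℚ ∑ℚ c (suc s) g ∎
  where
  lengths : (c ∸ a) + (suc s ∸ c) ≡ suc s ∸ a
  lengths = trans (sym (ℕ.+-∸-comm (suc s ∸ c) a≤c)) (cong (_∸ a) (ℕ.m+[n∸m]≡n c≤1+s))
-- The first range overshoots s here; its surplus terms vanish, and the second range is empty.
... | inj₂ 1+s≤c = begin
  ∑₀ (suc s ∸ a) (λ i → g (a + i))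
    ≡⟨ ∑₀-extend (λ i → g (a + i)) (ℕ.∸-monoˡ-≤ a 1+s≤c)
         (λ i le → g-vanish (a + i) (ℕ.≤-trans (ℕ.m≤n+m∸n (suc s) a) (ℕ.+-monoʳ-≤ a le))) ⟩
  ∑ℚ a c g
    ≡⟨ ℚ.+-identityʳ (∑ℚ a c g) ⟨
  ∑ℚ a c g +ℚ ∑₀ 0 (λ i → g (c + i))
    ≡⟨ cong (λ k → ∑ℚ a c g +ℚ ∑₀ k (λ i → g (c + i))) (ℕ.m≤n⇒m∸n≡0 1+s≤c) ⟨
  ∑ℚ a c g +ℚ ∑ℚ c (suc s) g ∎

-- `X` and `Y` are the forms taken by one term `W` on the two sides of the threshold. They include
-- the scalar `t r` because some identities write a power of 2 in front of it.
∑<-split : ∀ a c s (t : ℕ → ℚ) (W X Y : ℕ → Series) → a ≤ c → (∀ r → s < r → t r ≡ 0ℚ) →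
  (∀ r → a ≤ r → r < c → X r ≈ t r · W r) → (∀ r → c ≤ r → Y r ≈ t r · W r) →
  ∀ m → ∑ℚ a (suc s) (λ r → t r *ℚ W r m) ≡ (∑< a c X ⊕ ∑< c (suc s) Y) m
∑<-split a c s t W X Y a≤c t-vanish X≈ Y≈ m = begin
  ∑ℚ a (suc s) (λ r → t r *ℚ W r m)
    ≡⟨ ∑ℚ-split a c s (λ r → t r *ℚ W r m) a≤c
         (λ r s<r → trans (cong (_*ℚ W r m) (t-vanish r s<r)) (ℚ.*-zeroˡ (W r m))) ⟩
  ∑ℚ a c (λ r → t r *ℚ W r m) +ℚ ∑ℚ c (suc s) (λ r → t r *ℚ W r m)
    ≡⟨ cong₂ _+ℚ_
         (∑₀-cong (c ∸ a) (λ i i<c∸a → X≈ (a + i) (ℕ.m≤m+n a i)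
           (subst (a + i <_) (ℕ.m+[n∸m]≡n a≤c) (ℕ.+-monoʳ-< a i<c∸a)) m))
         (∑₀-cong (suc s ∸ c) (λ i _ → Y≈ (c + i) (ℕ.m≤m+n c i) m)) ⟨
  ∑ℚ a c (λ r → X r m) +ℚ ∑ℚ c (suc s) (λ r → Y r m)
    ≡⟨ cong₂ _+ℚ_ (∑<-coeff a c X m) (∑<-coeff c (suc s) Y m) ⟨
  (∑< a c X ⊕ ∑< c (suc s) Y) m ∎

-- The series of the theorem, with the two signs as parameters

⟦_⟧ : Sign → ℚ
⟦ pos ⟧ = 1ℚ
⟦ neg ⟧ = ℚ.- 1ℚ

-- Defined by cases, like `denom`, instead of through multiplication by a sign: the series of the
-- theorem are then instances by computation.
alternate : Sign → ℕ → Series → Series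
alternate pos n f = f
alternate neg n f = -1^ n · f

denom : Sign → Series → Series
denom pos f = 𝟙 ⊖ f
denom neg f = 𝟙 ⊕ f

weight : Sign → (ℕ → ℕ) → ℕ → ℕ → ℚ
weight ε w i n = sign ⟦ ε ⟧ n *ℚ fromℕ (w n) ^ℚ i

1^ℚ : ∀ n → 1ℚ ^ℚ n ≡ 1ℚ
1^ℚ zero    = refl
1^ℚ (suc n) = trans (ℚ.*-identityˡ (1ℚ ^ℚ n)) (1^ℚ n)

alternate-· : ∀ ε n f → alternate ε n f ≈ ⟦ ε ⟧ ^ℚ n · f
alternate-· pos n f m = sym (trans (cong (_*ℚ f m) (1^ℚ n)) (ℚ.*-identityˡ (f m)))
alternate-· neg n f m = refl

denom-⊖ : ∀ δ f → denom δ f ≈ 𝟙 ⊖ ⟦ δ ⟧ · f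
denom-⊖ pos f m = cong (λ a → 𝟙 m -ℚ a) (sym (ℚ.*-identityˡ (f m)))
denom-⊖ neg f m = solve 2 (λ a b → a :+ b := a :- con (ℚ.- 1ℚ) :* b) refl (𝟙 m) (f m)

series : Sign → (ℕ → ℕ) → ℕ → (ℕ → Series) → Series
series ε w i g = ∑[ n ≥ 1 ] alternate ε (n ∸ 1) (fromℕ (w n ^ i) · g n)

series-expand : ∀ c ε w i g u v b → (∀ n → c · g (suc n) ≈ lacunary (λ l → u (suc n) * v l) b) →
  c · series ε w i g ≈ doubleSeries u v (weight ε w i) b
series-expand c ε w i g u v b g≈ m = trans
  (*-distribˡ-∑₀ m c (λ n → alternate ε n (fromℕ (w (suc n) ^ i) · g (suc n)) m))
  (∑₀-cong m (λ n _ → begin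
    c *ℚ alternate ε n (fromℕ (w (suc n) ^ i) · g (suc n)) m
      ≡⟨ cong (c *ℚ_) (alternate-· ε n (fromℕ (w (suc n) ^ i) · g (suc n)) m) ⟩
    c *ℚ (⟦ ε ⟧ ^ℚ n *ℚ (fromℕ (w (suc n) ^ i) *ℚ g (suc n) m))
      ≡⟨ cong (λ a → c *ℚ (⟦ ε ⟧ ^ℚ n *ℚ (a *ℚ g (suc n) m))) (fromℕ-homo-^ (w (suc n)) i) ⟩
    c *ℚ (⟦ ε ⟧ ^ℚ n *ℚ (fromℕ (w (suc n)) ^ℚ i *ℚ g (suc n) m))
      ≡⟨ solve 4 (λ c e a g → c :* (e :* (a :* g)) := (e :* a) :* (c :* g)) refl
           c (⟦ ε ⟧ ^ℚ n) (fromℕ (w (suc n)) ^ℚ i) (g (suc n) m) ⟩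
    weight ε w i (suc n) *ℚ (c *ℚ g (suc n) m)
      ≡⟨ cong (weight ε w i (suc n) *ℚ_) (g≈ n m) ⟩
    weight ε w i (suc n) *ℚ lacunary (λ l → u (suc n) * v l) b m ∎))

lambert-expand : ∀ ε δ w i u v (num d : ℕ → ℕ) → Expanding u → Expanding v →
  (∀ n → num n ≡ u n * v 1) → (∀ n l → u n * v (suc (suc l)) ≡ d n + u n * v (suc l)) → (∀ n → 1 ≤ d (suc n)) →
  series ε w i (λ n → x^ (num n) ⊘ denom δ (x^ (d n))) ≈ doubleSeries u v (weight ε w i) (sign ⟦ δ ⟧)
lambert-expand ε δ w i u v num d u≥ v≥ num≡ step 1≤d = ≈-trans
  (λ m → sym (ℚ.*-identityˡ (series ε w i (λ n → x^ (num n) ⊘ denom δ (x^ (d n))) m)))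
  (series-expand 1ℚ ε w i (λ n → x^ (num n) ⊘ denom δ (x^ (d n))) u v (sign ⟦ δ ⟧) (λ n m → begin
    1ℚ *ℚ (x^ (num (suc n)) ⊘ denom δ (x^ (d (suc n)))) m
      ≡⟨ ℚ.*-identityˡ ((x^ (num (suc n)) ⊘ denom δ (x^ (d (suc n)))) m) ⟩
    (x^ (num (suc n)) ⊘ denom δ (x^ (d (suc n)))) m
      ≡⟨ ⊘-cong (λ k → cong (λ e → (x^ e) k) (num≡ (suc n))) (denom-⊖ δ (x^ (d (suc n)))) m ⟩
    (x^ (u (suc n) * v 1) ⊘ (𝟙 ⊖ ⟦ δ ⟧ · x^ (d (suc n)))) m
      ≡⟨ geometric ⟦ δ ⟧ (d (suc n)) (λ l → u (suc n) * v l)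
           (*-expanding (u (suc n)) v (ℕ.≤-trans (s≤s z≤n) (u≥ (suc n))) v≥) (step (suc n)) (1≤d n) m ⟩
    lacunary (λ l → u (suc n) * v l) (sign ⟦ δ ⟧) m ∎))

powers : Sign → Sign → (ℕ → ℕ) → (ℕ → ℕ) → (ℕ → ℕ) → ℕ → ℕ → Series
powers ε δ u w num k i = series ε w i (λ n → x^ (num n) ⊘ denom δ (x^ (2 * u n)) ⊛^ k)

module _ (ε δ : Sign) (u w : ℕ → ℕ) (i : ℕ) where

  -- The double series that a central factorial number of index r multiplies once `Φ` or `Ψ` is
  -- expanded; l - ½ appears as `½ *ℚ fromℕ (odd l)`.
  evenTerm oddTerm : ℕ → Series
  evenTerm r = doubleSeries u double (weight ε w i) (λ l → sign ⟦ δ ⟧ l *ℚ fromℕ l ^ℚ (2 * r ∸ 1))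
  oddTerm  r = doubleSeries u odd (weight ε w i) (λ l → sign ⟦ δ ⟧ l *ℚ (½ *ℚ fromℕ (odd l)) ^ℚ (2 * r))

module _ (ε δ : Sign) (u w num : ℕ → ℕ) (u≥ : Expanding u) (i : ℕ) where

  private
    -- The sign δ^t joins the factorial, as in `oddCoeff` and `evenCoeff`, so that `PowerExpansion`
    -- applies for each n.
    powers-expand : ∀ c t k v b → (∀ n → num n ≡ u n * k) →
      (∀ n → 1 ≤ n → (c *ℚ ⟦ δ ⟧ ^ℚ t) · (x^ (u n * k) ⊘ (𝟙 ⊖ ⟦ δ ⟧ · x^ (2 * u n)) ⊛^ k) ≈ lacunary (λ l → u n * v l) b) →
      c · alternate δ t (powers ε δ u w num k i) ≈ doubleSeries u v (weight ε w i) b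
    powers-expand c t k v b num≡ expansion m = begin
      c *ℚ alternate δ t (powers ε δ u w num k i) m
        ≡⟨ cong (c *ℚ_) (alternate-· δ t (powers ε δ u w num k i) m) ⟩
      c *ℚ (⟦ δ ⟧ ^ℚ t *ℚ powers ε δ u w num k i m)
        ≡⟨ ℚ.*-assoc c (⟦ δ ⟧ ^ℚ t) (powers ε δ u w num k i m) ⟨
      (c *ℚ ⟦ δ ⟧ ^ℚ t) *ℚ powers ε δ u w num k i m
        ≡⟨ series-expand (c *ℚ ⟦ δ ⟧ ^ℚ t) ε w i (λ n → x^ (num n) ⊘ denom δ (x^ (2 * u n)) ⊛^ k) u v b (λ n →
             ≈-trans (·-congˡ (c *ℚ ⟦ δ ⟧ ^ℚ t) (⊘-cong (λ j → cong (λ e → (x^ e) j) (num≡ (suc n)))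
               (⊛^-cong (denom-⊖ δ (x^ (2 * u (suc n)))) k)))
             (expansion (suc n) (s≤s z≤n))) m ⟩
      doubleSeries u v (weight ε w i) b m ∎

  -- In each use `c` is the first r at which the exponent of l is at least that of n; `X` and `Y`
  -- write `evenTerm` as a derivative without and with exchange of n and l.
  even-identity : ∀ t c (X Y : ℕ → Series) → (∀ n → num n ≡ u n * (2 * suc t)) → 1 ≤ c →
    (∀ r → 1 ≤ r → r < c → X r ≈ evenTerm ε δ u w i r) → (∀ r → c ≤ r → Y r ≈ evenTerm ε δ u w i r) →
    fromℕ ((2 * suc t ∸ 1) !) · alternate δ t (powers ε δ u w num (2 * suc t) i)
    ≈ (∑[ 1 ≤ r < c ] tₑ (suc t) r · X r) ⊕ (∑[ c ≤ r < suc (suc t) ] tₑ (suc t) r · Y r)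
  even-identity t c X Y num≡ 1≤c X≈ Y≈ m = begin
    (fromℕ ((2 * suc t ∸ 1) !) · alternate δ t (powers ε δ u w num (2 * suc t) i)) m
      ≡⟨ powers-expand (fromℕ ((2 * suc t ∸ 1) !)) t (2 * suc t) double b num≡ expansion m ⟩
    doubleSeries u double (weight ε w i) b m
      ≡⟨ doubleSeries-cong u double (weight ε w i) (weight ε w i) b
           (λ l → ∑₀ (suc t) (λ r → tₑ (suc t) (suc r) *ℚ (sign ⟦ δ ⟧ l *ℚ fromℕ l ^ℚ (2 * suc r ∸ 1))))
           (λ _ → refl) distribute m ⟩
    doubleSeries u double (weight ε w i)
      (λ l → ∑₀ (suc t) (λ r → tₑ (suc t) (suc r) *ℚ (sign ⟦ δ ⟧ l *ℚ fromℕ l ^ℚ (2 * suc r ∸ 1)))) m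
      ≡⟨ doubleSeries-∑ u double (suc t) (λ r → tₑ (suc t) (suc r)) (weight ε w i)
           (λ r l → sign ⟦ δ ⟧ l *ℚ fromℕ l ^ℚ (2 * suc r ∸ 1)) m ⟩
    ∑ℚ 1 (suc (suc t)) (λ r → tₑ (suc t) r *ℚ evenTerm ε δ u w i r m)
      ≡⟨ ∑<-split 1 c (suc t) (tₑ (suc t)) (evenTerm ε δ u w i) (λ r → tₑ (suc t) r · X r) (λ r → tₑ (suc t) r · Y r) 1≤c (tₑ-vanish t)
           (λ r 1≤r r<c → ·-congˡ (tₑ (suc t) r) (X≈ r 1≤r r<c)) (λ r c≤r → ·-congˡ (tₑ (suc t) r) (Y≈ r c≤r)) m ⟩
    ((∑[ 1 ≤ r < c ] tₑ (suc t) r · X r) ⊕ (∑[ c ≤ r < suc (suc t) ] tₑ (suc t) r · Y r)) m ∎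
    where
    b : ℕ → ℚ
    b l = sign ⟦ δ ⟧ l *ℚ Φ t (fromℕ l)
    expansion : ∀ n → 1 ≤ n → (fromℕ ((2 * suc t ∸ 1) !) *ℚ ⟦ δ ⟧ ^ℚ t)
      · (x^ (u n * (2 * suc t)) ⊘ (𝟙 ⊖ ⟦ δ ⟧ · x^ (2 * u n)) ⊛^ (2 * suc t)) ≈ lacunary (λ l → u n * double l) b
    expansion n 1≤n = subst
      (λ k → (fromℕ ((k ∸ 1) !) *ℚ ⟦ δ ⟧ ^ℚ t) · (x^ (u n * k) ⊘ (𝟙 ⊖ ⟦ δ ⟧ · x^ (2 * u n)) ⊛^ k) ≈ lacunary (λ l → u n * double l) b)
      (sym (ℕ.*-suc 2 t)) (PowerExpansion.even-expansion ⟦ δ ⟧ (u n) (ℕ.≤-trans 1≤n (u≥ n)) t)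
    distribute : ∀ l → b (suc l)
      ≡ ∑₀ (suc t) (λ r → tₑ (suc t) (suc r) *ℚ (sign ⟦ δ ⟧ (suc l) *ℚ fromℕ (suc l) ^ℚ (2 * suc r ∸ 1)))
    distribute l = trans (cong (sign ⟦ δ ⟧ (suc l) *ℚ_) (Φ-expand t (fromℕ (suc l))))
      (trans (*-distribˡ-∑₀ (suc t) (sign ⟦ δ ⟧ (suc l)) (λ r → tₑ (suc t) (suc r) *ℚ fromℕ (suc l) ^ℚ (2 * suc r ∸ 1)))
      (∑₀-cong (suc t) (λ r _ → solve 3 (λ a b c → a :* (b :* c) := b :* (a :* c)) refl
        (sign ⟦ δ ⟧ (suc l)) (tₑ (suc t) (suc r)) (fromℕ (suc l) ^ℚ (2 * suc r ∸ 1)))))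

  odd-identity : ∀ s c (X Y : ℕ → Series) → (∀ n → num n ≡ u n * (2 * s + 1)) →
    (∀ r → r < c → X r ≈ tₒ s r · oddTerm ε δ u w i r) → (∀ r → c ≤ r → Y r ≈ tₒ s r · oddTerm ε δ u w i r) →
    fromℕ ((2 * s) !) · alternate δ s (powers ε δ u w num (2 * s + 1) i)
    ≈ (∑[ 0 ≤ r < c ] X r) ⊕ (∑[ c ≤ r < suc s ] Y r)
  odd-identity s c X Y num≡ X≈ Y≈ m = begin
    (fromℕ ((2 * s) !) · alternate δ s (powers ε δ u w num (2 * s + 1) i)) m
      ≡⟨ powers-expand (fromℕ ((2 * s) !)) s (2 * s + 1) odd b num≡ expansion m ⟩
    doubleSeries u odd (weight ε w i) b m
      ≡⟨ doubleSeries-cong u odd (weight ε w i) (weight ε w i) b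
           (λ l → ∑₀ (suc s) (λ r → tₒ s r *ℚ (sign ⟦ δ ⟧ l *ℚ (½ *ℚ fromℕ (odd l)) ^ℚ (2 * r))))
           (λ _ → refl) distribute m ⟩
    doubleSeries u odd (weight ε w i)
      (λ l → ∑₀ (suc s) (λ r → tₒ s r *ℚ (sign ⟦ δ ⟧ l *ℚ (½ *ℚ fromℕ (odd l)) ^ℚ (2 * r)))) m
      ≡⟨ doubleSeries-∑ u odd (suc s) (tₒ s) (weight ε w i)
           (λ r l → sign ⟦ δ ⟧ l *ℚ (½ *ℚ fromℕ (odd l)) ^ℚ (2 * r)) m ⟩
    ∑ℚ 0 (suc s) (λ r → tₒ s r *ℚ oddTerm ε δ u w i r m)
      ≡⟨ ∑<-split 0 c s (tₒ s) (oddTerm ε δ u w i) X Y z≤n (tₒ-vanish s) (λ r _ → X≈ r) Y≈ m ⟩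
    ((∑[ 0 ≤ r < c ] X r) ⊕ (∑[ c ≤ r < suc s ] Y r)) m ∎
    where
    b : ℕ → ℚ
    b l = sign ⟦ δ ⟧ l *ℚ Ψ s (fromℕ l)
    expansion : ∀ n → 1 ≤ n → (fromℕ ((2 * s) !) *ℚ ⟦ δ ⟧ ^ℚ s)
      · (x^ (u n * (2 * s + 1)) ⊘ (𝟙 ⊖ ⟦ δ ⟧ · x^ (2 * u n)) ⊛^ (2 * s + 1)) ≈ lacunary (λ l → u n * odd l) b
    expansion n 1≤n = subst
      (λ k → (fromℕ ((2 * s) !) *ℚ ⟦ δ ⟧ ^ℚ s) · (x^ (u n * k) ⊘ (𝟙 ⊖ ⟦ δ ⟧ · x^ (2 * u n)) ⊛^ k) ≈ lacunary (λ l → u n * odd l) b)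
      (ℕ.+-comm 1 (2 * s)) (PowerExpansion.odd-expansion ⟦ δ ⟧ (u n) (ℕ.≤-trans 1≤n (u≥ n)) s)
    half-odd : ∀ l → fromℕ (suc l) -ℚ ½ ≡ ½ *ℚ fromℕ (odd (suc l))
    half-odd l = trans (cong (_-ℚ ½) (fromℕ-suc l)) (trans
      (solve 1 (λ z → (z :+ con 1ℚ) :- con ½ := con ½ :* (con (fromℕ 2) :* z :+ con 1ℚ)) refl (fromℕ l))
      (cong (½ *ℚ_) (sym (fromℕ-odd l))))
    distribute : ∀ l → b (suc l)
      ≡ ∑₀ (suc s) (λ r → tₒ s r *ℚ (sign ⟦ δ ⟧ (suc l) *ℚ (½ *ℚ fromℕ (odd (suc l))) ^ℚ (2 * r)))
    distribute l = trans (cong (sign ⟦ δ ⟧ (suc l) *ℚ_) (Ψ-expand s (fromℕ (suc l))))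
      (trans (*-distribˡ-∑₀ (suc s) (sign ⟦ δ ⟧ (suc l)) (λ r → tₒ s r *ℚ (fromℕ (suc l) -ℚ ½) ^ℚ (2 * r)))
      (∑₀-cong (suc s) (λ r _ → trans (cong (λ z → sign ⟦ δ ⟧ (suc l) *ℚ (tₒ s r *ℚ z ^ℚ (2 * r))) (half-odd l))
        (solve 3 (λ a b c → a :* (b :* c) := b :* (a :* c)) refl
          (sign ⟦ δ ⟧ (suc l)) (tₒ s r) ((½ *ℚ fromℕ (odd (suc l))) ^ℚ (2 * r))))))

-- Lambert series: four families, each indexed by two signs

lambertA lambertC lambertF lambertH : Sign → Sign → ℕ → Series
lambertA ε δ i = series ε id  i (λ n → q^ n ⊘ denom δ (q^ n))
lambertC ε δ i = series ε id  i (λ n → q^ n ⊘ denom δ (q^ (2 * n)))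
lambertF ε δ i = series ε odd i (λ n → q^ (odd n) ⊘ denom δ (q^ (odd n)))
lambertH ε δ i = series ε odd i (λ n → x^ (odd n) ⊘ denom δ (q^ (odd n)))

id-expanding : Expanding id
id-expanding n = ℕ.≤-refl

private
  1≤2*odd : ∀ n → 1 ≤ 2 * odd (suc n)
  1≤2*odd n = ℕ.≤-trans (s≤s z≤n) (ℕ.≤-trans (odd-expanding (suc n)) (double-expanding (odd (suc n))))

lambertA-expand : ∀ ε δ i → lambertA ε δ i ≈ doubleSeries double id (weight ε id i) (sign ⟦ δ ⟧)
lambertA-expand ε δ i = lambert-expand ε δ id i double id double double double-expanding id-expanding
  (λ n → sym (ℕ.*-identityʳ (2 * n))) (λ n l → ℕ.*-suc (2 * n) (suc l)) (λ n → s≤s z≤n)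

lambertC-expand : ∀ ε δ i → lambertC ε δ i ≈ doubleSeries double odd (weight ε id i) (sign ⟦ δ ⟧)
lambertC-expand ε δ i = lambert-expand ε δ id i double odd double (λ n → 2 * (2 * n)) double-expanding odd-expanding
  (λ n → sym (ℕ.*-identityʳ (2 * n))) (λ n → u*odd-step (2 * n)) (λ n → s≤s z≤n)

-- The factor 2 of the exponent goes to l here and to n for `lambertC`. Exchanging n and l therefore
-- carries the families F and C into each other's shape, while H, and A after q → q², keep theirs.
lambertF-expand : ∀ ε δ i → lambertF ε δ i ≈ doubleSeries odd double (weight ε odd i) (sign ⟦ δ ⟧)
lambertF-expand ε δ i = lambert-expand ε δ odd i odd double (λ n → 2 * odd n) (λ n → 2 * odd n) odd-expanding double-expanding
  (λ n → ℕ.*-comm 2 (odd n)) (λ n → u*double-step (odd n)) 1≤2*odd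

lambertH-expand : ∀ ε δ i → lambertH ε δ i ≈ doubleSeries odd odd (weight ε odd i) (sign ⟦ δ ⟧)
lambertH-expand ε δ i = lambert-expand ε δ odd i odd odd odd (λ n → 2 * odd n) odd-expanding odd-expanding
  (λ n → sym (ℕ.*-identityʳ (odd n))) (λ n → u*odd-step (odd n)) 1≤2*odd

½*double : ∀ m n → ½ *ℚ fromℕ (double m * n) ≡ fromℕ m *ℚ fromℕ n
½*double m n = begin
  ½ *ℚ fromℕ (2 * m * n)                  ≡⟨ cong (½ *ℚ_) (trans (fromℕ-homo-* (2 * m) n) (cong (_*ℚ fromℕ n) (fromℕ-homo-* 2 m))) ⟩
  ½ *ℚ (fromℕ 2 *ℚ fromℕ m *ℚ fromℕ n)    ≡⟨ solve 2 (λ a b → con ½ :* (con (fromℕ 2) :* a :* b) := a :* b) refl (fromℕ m) (fromℕ n) ⟩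
  fromℕ m *ℚ fromℕ n                      ∎

eigen-double : ∀ v → Eigen double v fromℕ (fromℕ ∘ v)
eigen-double v n l = ½*double (suc n) (v (suc l))

eigen-odd-double : Eigen odd double (fromℕ ∘ odd) fromℕ
eigen-odd-double n l = trans (cong (λ k → ½ *ℚ fromℕ k) (ℕ.*-comm (odd (suc n)) (double (suc l))))
  (trans (½*double (suc l) (odd (suc n))) (ℚ.*-comm (fromℕ (suc l)) (fromℕ (odd (suc n)))))

-- With two odd factors the ½ can go to either. It is given to the variable that ends up as l, whose
-- powers in `oddTerm` are powers of ½(2l-1); hence a second version for the exchanged case.
eigen-odd-half : Eigen odd odd (fromℕ ∘ odd) (λ l → ½ *ℚ fromℕ (odd l))
eigen-odd-half n l = trans (cong (½ *ℚ_) (fromℕ-homo-* (odd (suc n)) (odd (suc l))))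
  (solve 2 (λ a b → con ½ :* (a :* b) := a :* (con ½ :* b)) refl (fromℕ (odd (suc n))) (fromℕ (odd (suc l))))

eigen-half-odd : Eigen odd odd (λ l → ½ *ℚ fromℕ (odd l)) (fromℕ ∘ odd)
eigen-half-odd n l = trans (cong (½ *ℚ_) (fromℕ-homo-* (odd (suc n)) (odd (suc l))))
  (sym (ℚ.*-assoc ½ (fromℕ (odd (suc n))) (fromℕ (odd (suc l)))))

𝐃^-weight : ∀ u v w w′ → Eigen u v (fromℕ ∘ w) w′ → ∀ ε b i k p G → i + k ≡ p →
  G ≈ doubleSeries u v (weight ε w i) b →
  𝐃^ k G ≈ doubleSeries u v (weight ε w p) (λ l → b l *ℚ w′ l ^ℚ k)
𝐃^-weight u v w w′ eigen ε b i k p G i+k≡p G≈ = ≈-trans (𝐃^-cong k G≈)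
  (≈-trans (𝐃^-doubleSeries u v (fromℕ ∘ w) w′ eigen k (weight ε w i) b)
  (doubleSeries-cong u v (λ n → weight ε w i n *ℚ fromℕ (w n) ^ℚ k) (weight ε w p) (λ l → b l *ℚ w′ l ^ℚ k) (λ l → b l *ℚ w′ l ^ℚ k)
    (λ n → begin
      (sign ⟦ ε ⟧ (suc n) *ℚ fromℕ (w (suc n)) ^ℚ i) *ℚ fromℕ (w (suc n)) ^ℚ k
        ≡⟨ ℚ.*-assoc (sign ⟦ ε ⟧ (suc n)) (fromℕ (w (suc n)) ^ℚ i) (fromℕ (w (suc n)) ^ℚ k) ⟩
      sign ⟦ ε ⟧ (suc n) *ℚ (fromℕ (w (suc n)) ^ℚ i *ℚ fromℕ (w (suc n)) ^ℚ k)
        ≡⟨ cong (sign ⟦ ε ⟧ (suc n) *ℚ_) (ℚ-Exp.^-homo-* (fromℕ (w (suc n))) i k) ⟨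
      sign ⟦ ε ⟧ (suc n) *ℚ fromℕ (w (suc n)) ^ℚ (i + k)
        ≡⟨ cong (λ e → sign ⟦ ε ⟧ (suc n) *ℚ fromℕ (w (suc n)) ^ℚ e) i+k≡p ⟩
      weight ε w p (suc n) ∎) (λ _ → refl)))

2^-neg : ∀ n → 2^ (- (+ n)) ≡ ½ ^ℚ n
2^-neg zero    = refl
2^-neg (suc n) = refl

2^-sub : ∀ {m n} → m ≤ n → 2^ (+ m - + n) ≡ ½ ^ℚ (n ∸ m)
2^-sub {m} {n} m≤n = trans (cong 2^_ (trans (ℤ.m-n≡m⊖n m n) (ℤ.⊖-≤ m≤n))) (2^-neg (n ∸ m))

scale-doubleSeries : ∀ c u v a b b′ t G → (∀ l → c *ℚ b (suc l) ≡ b′ (suc l)) →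
  G ≈ doubleSeries u v a b → c · t · G ≈ t · doubleSeries u v a b′
scale-doubleSeries c u v a b b′ t G cb≡b′ G≈ m = begin
  c *ℚ (t *ℚ G m)
    ≡⟨ solve 3 (λ c t g → c :* (t :* g) := t :* (c :* g)) refl c t (G m) ⟩
  t *ℚ (c *ℚ G m)
    ≡⟨ cong (λ g → t *ℚ (c *ℚ g)) (G≈ m) ⟩
  t *ℚ (c *ℚ doubleSeries u v a b m)
    ≡⟨ cong (t *ℚ_) (doubleSeries-· u v c a b m) ⟨
  t *ℚ doubleSeries u v a (λ l → c *ℚ b l) m
    ≡⟨ cong (t *ℚ_) (doubleSeries-cong u v a a (λ l → c *ℚ b l) b′ (λ _ → refl) cb≡b′ m) ⟩
  t *ℚ doubleSeries u v a b′ m ∎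

½^-*-^ : ∀ k s z → ½ ^ℚ k *ℚ (s *ℚ z ^ℚ k) ≡ s *ℚ (½ *ℚ z) ^ℚ k
½^-*-^ k s z = trans (solve 3 (λ h s y → h :* (s :* y) := s :* (h :* y)) refl (½ ^ℚ k) s (z ^ℚ k))
  (cong (s *ℚ_) (sym (ℚ-Exp.^-distrib-* ½ z k)))

powersₑ powersₒ : Sign → Sign → ℕ → ℕ → Series
powersₑ ε δ k = powers ε δ double id (λ n → 2 * (n * k)) k
powersₒ ε δ k = powers ε δ odd odd (λ n → odd n * k) k

module _ (ε δ : Sign) (i : ℕ) where

  -- The first letter tells whether `u` is `double` or `odd`, the second the same for `v`.
  termEE termOE termEO termOO : ℕ → Series
  termEE = evenTerm ε δ double id i
  termOE = evenTerm ε δ odd odd i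
  termEO = oddTerm ε δ double id i
  termOO = oddTerm ε δ odd odd i

  𝐃^-lambertA : ∀ r j → j + (2 * r ∸ 1) ≡ i → (𝐃^ (2 * r ∸ 1) (lambertA ε δ j)) ⟨q²⟩ ≈ termEE r
  𝐃^-lambertA r j eq = ≈-trans
    (⟨q²⟩-cong (𝐃^-weight double id id fromℕ (eigen-double id) ε (sign ⟦ δ ⟧) j (2 * r ∸ 1) i (lambertA ε δ j) eq (lambertA-expand ε δ j)))
    (doubleSeries-⟨q²⟩ double id double-expanding id-expanding (weight ε id i) (λ l → sign ⟦ δ ⟧ l *ℚ fromℕ l ^ℚ (2 * r ∸ 1)))

  -- 𝐃^i supplies all of n^i and as many powers of l. The other j powers of l come from the Lambert
  -- series, whose summation variable is l; hence the exchanged signs.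
  𝐃^-lambertA-swap : ∀ r j → j + i ≡ 2 * r ∸ 1 → (𝐃^ i (lambertA δ ε j)) ⟨q²⟩ ≈ termEE r
  𝐃^-lambertA-swap r j eq = ≈-trans
    (⟨q²⟩-cong (𝐃^-weight double id id fromℕ (eigen-double id) δ (sign ⟦ ε ⟧) j i (2 * r ∸ 1) (lambertA δ ε j) eq (lambertA-expand δ ε j)))
    (≈-trans (doubleSeries-⟨q²⟩ double id double-expanding id-expanding (weight δ id (2 * r ∸ 1)) (λ l → sign ⟦ ε ⟧ l *ℚ fromℕ l ^ℚ i))
    (doubleSeries-swap double double (weight δ id (2 * r ∸ 1)) (weight ε id i)))

  𝐃^-lambertF : ∀ r j → j + (2 * r ∸ 1) ≡ i → 𝐃^ (2 * r ∸ 1) (lambertF ε δ j) ≈ termOE r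
  𝐃^-lambertF r j eq =
    𝐃^-weight odd double odd fromℕ eigen-odd-double ε (sign ⟦ δ ⟧) j (2 * r ∸ 1) i (lambertF ε δ j) eq (lambertF-expand ε δ j)

  𝐃^-lambertC-swap : ∀ r j → j + i ≡ 2 * r ∸ 1 → 𝐃^ i (lambertC δ ε j) ≈ termOE r
  𝐃^-lambertC-swap r j eq = ≈-trans
    (𝐃^-weight double odd id (fromℕ ∘ odd) (eigen-double odd) δ (sign ⟦ ε ⟧) j i (2 * r ∸ 1) (lambertC δ ε j) eq (lambertC-expand δ ε j))
    (doubleSeries-swap double odd (weight δ id (2 * r ∸ 1)) (weight ε odd i))

  -- Each 𝐃 contributes n(2l-1) without a ½, and the term needs 2r halves.
  𝐃^-lambertC : ∀ t r j → j + 2 * r ≡ i → 2^ (- (+ (2 * r))) · t · 𝐃^ (2 * r) (lambertC ε δ j) ≈ t · termEO r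
  𝐃^-lambertC t r j eq = scale-doubleSeries (2^ (- (+ (2 * r)))) double odd (weight ε id i) (λ l → sign ⟦ δ ⟧ l *ℚ fromℕ (odd l) ^ℚ (2 * r))
    (λ l → sign ⟦ δ ⟧ l *ℚ (½ *ℚ fromℕ (odd l)) ^ℚ (2 * r)) t (𝐃^ (2 * r) (lambertC ε δ j))
    (λ l → trans (cong (_*ℚ (sign ⟦ δ ⟧ (suc l) *ℚ fromℕ (odd (suc l)) ^ℚ (2 * r))) (2^-neg (2 * r)))
      (½^-*-^ (2 * r) (sign ⟦ δ ⟧ (suc l)) (fromℕ (odd (suc l)))))
    (𝐃^-weight double odd id (fromℕ ∘ odd) (eigen-double odd) ε (sign ⟦ δ ⟧) j (2 * r) i (lambertC ε δ j) eq (lambertC-expand ε δ j))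

  𝐃^-lambertF-swap : ∀ t r j → j + i ≡ 2 * r → 2^ (- (+ (2 * r))) · t · 𝐃^ i (lambertF δ ε j) ≈ t · termEO r
  𝐃^-lambertF-swap t r j eq = scale-doubleSeries (2^ (- (+ (2 * r)))) double odd (weight ε id i) (weight δ odd (2 * r))
    (λ l → sign ⟦ δ ⟧ l *ℚ (½ *ℚ fromℕ (odd l)) ^ℚ (2 * r)) t (𝐃^ i (lambertF δ ε j))
    (λ l → trans (cong (_*ℚ (sign ⟦ δ ⟧ (suc l) *ℚ fromℕ (odd (suc l)) ^ℚ (2 * r))) (2^-neg (2 * r)))
      (½^-*-^ (2 * r) (sign ⟦ δ ⟧ (suc l)) (fromℕ (odd (suc l)))))
    (≈-trans (𝐃^-weight odd double odd fromℕ eigen-odd-double δ (sign ⟦ ε ⟧) j i (2 * r) (lambertF δ ε j) eq (lambertF-expand δ ε j))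
      (doubleSeries-swap odd double (weight δ odd (2 * r)) (weight ε id i)))

  𝐃^-lambertH : ∀ r j → j + 2 * r ≡ i → 𝐃^ (2 * r) (lambertH ε δ j) ≈ termOO r
  𝐃^-lambertH r j eq = 𝐃^-weight odd odd odd (λ l → ½ *ℚ fromℕ (odd l)) eigen-odd-half ε (sign ⟦ δ ⟧) j (2 * r) i
    (lambertH ε δ j) eq (lambertH-expand ε δ j)

  -- Of the 2r halves that the term needs, 𝐃^i brings i; the scalar 2^(i-2r) is the missing ½^j.
  𝐃^-lambertH-swap : ∀ t r j → j + i ≡ 2 * r → 2^ (+ i - + (2 * r)) · t · 𝐃^ i (lambertH δ ε j) ≈ t · termOO r
  𝐃^-lambertH-swap t r j eq = scale-doubleSeries (2^ (+ i - + (2 * r))) odd odd (weight ε odd i)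
    (λ l → weight δ odd j l *ℚ (½ *ℚ fromℕ (odd l)) ^ℚ i)
    (λ l → sign ⟦ δ ⟧ l *ℚ (½ *ℚ fromℕ (odd l)) ^ℚ (2 * r)) t (𝐃^ i (lambertH δ ε j))
    (λ l → rescale (sign ⟦ δ ⟧ (suc l)) (fromℕ (odd (suc l))))
    (≈-trans (𝐃^-cong i (lambertH-expand δ ε j))
    (≈-trans (𝐃^-doubleSeries odd odd (λ l → ½ *ℚ fromℕ (odd l)) (fromℕ ∘ odd) eigen-half-odd i (weight δ odd j) (sign ⟦ ε ⟧))
      (doubleSeries-swap odd odd (λ l → weight δ odd j l *ℚ (½ *ℚ fromℕ (odd l)) ^ℚ i) (weight ε odd i))))
    where
    2^≡½^j : 2^ (+ i - + (2 * r)) ≡ ½ ^ℚ j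
    2^≡½^j = trans (2^-sub (subst (i ≤_) eq (ℕ.m≤n+m i j)))
      (cong (½ ^ℚ_) (trans (cong (_∸ i) (sym eq)) (ℕ.m+n∸n≡m j i)))
    rescale : ∀ s z → 2^ (+ i - + (2 * r)) *ℚ ((s *ℚ z ^ℚ j) *ℚ (½ *ℚ z) ^ℚ i) ≡ s *ℚ (½ *ℚ z) ^ℚ (2 * r)
    rescale s z = begin
      2^ (+ i - + (2 * r)) *ℚ ((s *ℚ z ^ℚ j) *ℚ (½ *ℚ z) ^ℚ i)
        ≡⟨ cong (_*ℚ ((s *ℚ z ^ℚ j) *ℚ (½ *ℚ z) ^ℚ i)) 2^≡½^j ⟩
      ½ ^ℚ j *ℚ ((s *ℚ z ^ℚ j) *ℚ (½ *ℚ z) ^ℚ i)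
        ≡⟨ ℚ.*-assoc (½ ^ℚ j) (s *ℚ z ^ℚ j) ((½ *ℚ z) ^ℚ i) ⟨
      (½ ^ℚ j *ℚ (s *ℚ z ^ℚ j)) *ℚ (½ *ℚ z) ^ℚ i
        ≡⟨ cong (_*ℚ (½ *ℚ z) ^ℚ i) (½^-*-^ j s z) ⟩
      (s *ℚ (½ *ℚ z) ^ℚ j) *ℚ (½ *ℚ z) ^ℚ i
        ≡⟨ ℚ.*-assoc s ((½ *ℚ z) ^ℚ j) ((½ *ℚ z) ^ℚ i) ⟩
      s *ℚ ((½ *ℚ z) ^ℚ j *ℚ (½ *ℚ z) ^ℚ i)
        ≡⟨ cong (s *ℚ_) (ℚ-Exp.^-homo-* (½ *ℚ z) j i) ⟨
      s *ℚ (½ *ℚ z) ^ℚ (j + i)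
        ≡⟨ cong (λ k → s *ℚ (½ *ℚ z) ^ℚ k) eq ⟩
      s *ℚ (½ *ℚ z) ^ℚ (2 * r) ∎

-- Arithmetic of exponents under truncated subtraction

private
  module Exponents (r p : ℕ) where

    2p∸2r+2r : r ≤ p → 2 * p ∸ 2 * r + 2 * r ≡ 2 * p
    2p∸2r+2r r≤p = ℕ.m∸n+n≡m (ℕ.*-monoʳ-≤ 2 r≤p)

    2p∸2r+1+2r : r ≤ p → 2 * p ∸ 2 * r + 1 + 2 * r ≡ 2 * p + 1
    2p∸2r+1+2r r≤p = begin
      2 * p ∸ 2 * r + 1 + 2 * r      ≡⟨ ℕ.+-assoc (2 * p ∸ 2 * r) 1 (2 * r) ⟩
      2 * p ∸ 2 * r + (1 + 2 * r)    ≡⟨ cong (_+_ (2 * p ∸ 2 * r)) (ℕ.+-comm 1 (2 * r)) ⟩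
      2 * p ∸ 2 * r + (2 * r + 1)    ≡⟨ ℕ.+-assoc (2 * p ∸ 2 * r) (2 * r) 1 ⟨
      2 * p ∸ 2 * r + 2 * r + 1      ≡⟨ cong (_+ 1) (2p∸2r+2r r≤p) ⟩
      2 * p + 1                      ∎

    +[2r∸1] : 1 ≤ r → ∀ a k → a + suc k + (2 * r ∸ 1) ≡ a + k + 2 * r
    +[2r∸1] 1≤r a k = begin
      a + suc k + (2 * r ∸ 1)        ≡⟨ cong (_+ (2 * r ∸ 1)) (ℕ.+-suc a k) ⟩
      suc (a + k) + (2 * r ∸ 1)      ≡⟨ ℕ.+-suc (a + k) (2 * r ∸ 1) ⟨
      a + k + (1 + (2 * r ∸ 1))      ≡⟨ cong (_+_ (a + k)) (ℕ.m+[n∸m]≡n (ℕ.≤-trans 1≤r (double-expanding r))) ⟩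
      a + k + 2 * r                  ∎

    2p∸2r+1+[2r∸1] : 1 ≤ r → r ≤ p → 2 * p ∸ 2 * r + 1 + (2 * r ∸ 1) ≡ 2 * p
    2p∸2r+1+[2r∸1] 1≤r r≤p = trans (+[2r∸1] 1≤r (2 * p ∸ 2 * r) 0)
      (trans (cong (_+ 2 * r) (ℕ.+-identityʳ (2 * p ∸ 2 * r))) (2p∸2r+2r r≤p))

    2p∸2r+2+[2r∸1] : 1 ≤ r → r ≤ p → 2 * p ∸ 2 * r + 2 + (2 * r ∸ 1) ≡ 2 * p + 1
    2p∸2r+2+[2r∸1] 1≤r r≤p = trans (+[2r∸1] 1≤r (2 * p ∸ 2 * r) 1) (2p∸2r+1+2r r≤p)

    -- p < r gives 2p + 2 ≤ 2r, so no subtraction is truncated as long as k ≤ 2.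
    2r∸2p∸k+[2p+k] : ∀ k → k ≤ 2 → p < r → 2 * r ∸ 2 * p ∸ k + (2 * p + k) ≡ 2 * r
    2r∸2p∸k+[2p+k] k k≤2 p<r = trans (cong (_+ (2 * p + k)) (ℕ.∸-+-assoc (2 * r) (2 * p) k))
      (ℕ.m∸n+n≡m (ℕ.≤-trans (ℕ.+-monoʳ-≤ (2 * p) k≤2)
        (subst (_≤ 2 * r) (trans (ℕ.*-suc 2 p) (ℕ.+-comm 2 (2 * p))) (ℕ.*-monoʳ-≤ 2 p<r))))

    2r∸2p∸1+[2p+1] : p < r → 2 * r ∸ 2 * p ∸ 1 + (2 * p + 1) ≡ 2 * r
    2r∸2p∸1+[2p+1] = 2r∸2p∸k+[2p+k] 1 (s≤s z≤n)

    2r∸2p∸1+2p : p < r → 2 * r ∸ 2 * p ∸ 1 + 2 * p ≡ 2 * r ∸ 1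
    2r∸2p∸1+2p p<r = begin
      2 * r ∸ 2 * p ∸ 1 + 2 * p              ≡⟨ ℕ.m+n∸n≡m (2 * r ∸ 2 * p ∸ 1 + 2 * p) 1 ⟨
      2 * r ∸ 2 * p ∸ 1 + 2 * p + 1 ∸ 1      ≡⟨ cong (_∸ 1) (ℕ.+-assoc (2 * r ∸ 2 * p ∸ 1) (2 * p) 1) ⟩
      2 * r ∸ 2 * p ∸ 1 + (2 * p + 1) ∸ 1    ≡⟨ cong (_∸ 1) (2r∸2p∸1+[2p+1] p<r) ⟩
      2 * r ∸ 1                              ∎

    2r∸2p∸2+[2p+1] : p < r → 2 * r ∸ 2 * p ∸ 2 + (2 * p + 1) ≡ 2 * r ∸ 1
    2r∸2p∸2+[2p+1] p<r = begin
      2 * r ∸ 2 * p ∸ 2 + (2 * p + 1)            ≡⟨ ℕ.m+n∸n≡m (2 * r ∸ 2 * p ∸ 2 + (2 * p + 1)) 1 ⟨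
      2 * r ∸ 2 * p ∸ 2 + (2 * p + 1) + 1 ∸ 1    ≡⟨ cong (_∸ 1) (ℕ.+-assoc (2 * r ∸ 2 * p ∸ 2) (2 * p + 1) 1) ⟩
      2 * r ∸ 2 * p ∸ 2 + (2 * p + 1 + 1) ∸ 1    ≡⟨ cong (λ k → 2 * r ∸ 2 * p ∸ 2 + k ∸ 1) (ℕ.+-assoc (2 * p) 1 1) ⟩
      2 * r ∸ 2 * p ∸ 2 + (2 * p + 2) ∸ 1        ≡⟨ cong (_∸ 1) (2r∸2p∸k+[2p+k] 2 ℕ.≤-refl p<r) ⟩
      2 * r ∸ 1                                  ∎

-- The seven identities with free signs

module _ (ε δ : Sign) where
  open Exponents

  private
    q^-exponent : ∀ k n → 2 * (n * k) ≡ double n * k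
    q^-exponent k n = sym (ℕ.*-assoc 2 n k)

  -- In these names the subscript tells whether n or 2n-1 is summed over, the first word gives the
  -- parity of the power, and the second that of the exponent of n or 2n-1, which is even here.
  identityₑ-even : ∀ t p →
    fromℕ ((2 * suc t ∸ 1) !) · alternate δ t (powersₑ ε δ (2 * suc t) (2 * p))
    ≈ (∑[ 1 ≤ r < 1 + p ] tₑ (suc t) r · (𝐃^ (2 * r ∸ 1) (lambertA ε δ (2 * p ∸ 2 * r + 1))) ⟨q²⟩)
    ⊕ (∑[ 1 + p ≤ r < 1 + suc t ] tₑ (suc t) r · (𝐃^ (2 * p) (lambertA δ ε (2 * r ∸ 2 * p ∸ 1))) ⟨q²⟩)
  identityₑ-even t p = even-identity ε δ double id (λ n → 2 * (n * (2 * suc t))) double-expanding (2 * p) t (1 + p)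
    (λ r → (𝐃^ (2 * r ∸ 1) (lambertA ε δ (2 * p ∸ 2 * r + 1))) ⟨q²⟩)
    (λ r → (𝐃^ (2 * p) (lambertA δ ε (2 * r ∸ 2 * p ∸ 1))) ⟨q²⟩)
    (q^-exponent (2 * suc t)) (s≤s z≤n)
    (λ r 1≤r r≤p → 𝐃^-lambertA ε δ (2 * p) r (2 * p ∸ 2 * r + 1) (2p∸2r+1+[2r∸1] r p 1≤r (s≤s⁻¹ r≤p)))
    (λ r p<r → 𝐃^-lambertA-swap ε δ (2 * p) r (2 * r ∸ 2 * p ∸ 1) (2r∸2p∸1+2p r p p<r))

  identityₑ-odd-odd : ∀ s p →
    fromℕ ((2 * s) !) · alternate δ s (powersₑ ε δ (2 * s + 1) (2 * p + 1))
    ≈ (∑[ 0 ≤ r < 1 + p ] 2^ (- (+ (2 * r))) · tₒ s r · 𝐃^ (2 * r) (lambertC ε δ (2 * p ∸ 2 * r + 1)))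
    ⊕ (∑[ 1 + p ≤ r < 1 + s ] 2^ (- (+ (2 * r))) · tₒ s r · 𝐃^ (2 * p + 1) (lambertF δ ε (2 * r ∸ 2 * p ∸ 1)))
  identityₑ-odd-odd s p = odd-identity ε δ double id (λ n → 2 * (n * (2 * s + 1))) double-expanding (2 * p + 1) s (1 + p)
    (λ r → 2^ (- (+ (2 * r))) · tₒ s r · 𝐃^ (2 * r) (lambertC ε δ (2 * p ∸ 2 * r + 1)))
    (λ r → 2^ (- (+ (2 * r))) · tₒ s r · 𝐃^ (2 * p + 1) (lambertF δ ε (2 * r ∸ 2 * p ∸ 1)))
    (q^-exponent (2 * s + 1))
    (λ r r≤p → 𝐃^-lambertC ε δ (2 * p + 1) (tₒ s r) r (2 * p ∸ 2 * r + 1) (2p∸2r+1+2r r p (s≤s⁻¹ r≤p)))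
    (λ r p<r → 𝐃^-lambertF-swap ε δ (2 * p + 1) (tₒ s r) r (2 * r ∸ 2 * p ∸ 1) (2r∸2p∸1+[2p+1] r p p<r))

  identityₑ-odd-even : ∀ s p →
    fromℕ ((2 * s) !) · alternate δ s (powersₑ ε δ (2 * s + 1) (2 * p))
    ≈ (∑[ 0 ≤ r < p ] 2^ (- (+ (2 * r))) · tₒ s r · 𝐃^ (2 * r) (lambertC ε δ (2 * p ∸ 2 * r)))
    ⊕ (∑[ p ≤ r < 1 + s ] 2^ (- (+ (2 * r))) · tₒ s r · 𝐃^ (2 * p) (lambertF δ ε (2 * r ∸ 2 * p)))
  identityₑ-odd-even s p = odd-identity ε δ double id (λ n → 2 * (n * (2 * s + 1))) double-expanding (2 * p) s p
    (λ r → 2^ (- (+ (2 * r))) · tₒ s r · 𝐃^ (2 * r) (lambertC ε δ (2 * p ∸ 2 * r)))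
    (λ r → 2^ (- (+ (2 * r))) · tₒ s r · 𝐃^ (2 * p) (lambertF δ ε (2 * r ∸ 2 * p)))
    (q^-exponent (2 * s + 1))
    (λ r r<p → 𝐃^-lambertC ε δ (2 * p) (tₒ s r) r (2 * p ∸ 2 * r) (2p∸2r+2r r p (ℕ.<⇒≤ r<p)))
    -- The exponent lemma of the first range is reused with `r` and `p` exchanged.
    (λ r p≤r → 𝐃^-lambertF-swap ε δ (2 * p) (tₒ s r) r (2 * r ∸ 2 * p) (2p∸2r+2r p r p≤r))

  identityₒ-even-even : ∀ t p →
    fromℕ ((2 * suc t ∸ 1) !) · alternate δ t (powersₒ ε δ (2 * suc t) (2 * p))
    ≈ (∑[ 1 ≤ r < 1 + p ] tₑ (suc t) r · 𝐃^ (2 * r ∸ 1) (lambertF ε δ (2 * p ∸ 2 * r + 1)))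
    ⊕ (∑[ 1 + p ≤ r < 1 + suc t ] tₑ (suc t) r · 𝐃^ (2 * p) (lambertC δ ε (2 * r ∸ 2 * p ∸ 1)))
  identityₒ-even-even t p = even-identity ε δ odd odd (λ n → odd n * (2 * suc t)) odd-expanding (2 * p) t (1 + p)
    (λ r → 𝐃^ (2 * r ∸ 1) (lambertF ε δ (2 * p ∸ 2 * r + 1)))
    (λ r → 𝐃^ (2 * p) (lambertC δ ε (2 * r ∸ 2 * p ∸ 1)))
    (λ _ → refl) (s≤s z≤n)
    (λ r 1≤r r≤p → 𝐃^-lambertF ε δ (2 * p) r (2 * p ∸ 2 * r + 1) (2p∸2r+1+[2r∸1] r p 1≤r (s≤s⁻¹ r≤p)))
    (λ r p<r → 𝐃^-lambertC-swap ε δ (2 * p) r (2 * r ∸ 2 * p ∸ 1) (2r∸2p∸1+2p r p p<r))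

  identityₒ-even-odd : ∀ t p →
    fromℕ ((2 * suc t ∸ 1) !) · alternate δ t (powersₒ ε δ (2 * suc t) (2 * p + 1))
    ≈ (∑[ 1 ≤ r < 1 + p ] tₑ (suc t) r · 𝐃^ (2 * r ∸ 1) (lambertF ε δ (2 * p ∸ 2 * r + 2)))
    ⊕ (∑[ 1 + p ≤ r < 1 + suc t ] tₑ (suc t) r · 𝐃^ (2 * p + 1) (lambertC δ ε (2 * r ∸ 2 * p ∸ 2)))
  identityₒ-even-odd t p = even-identity ε δ odd odd (λ n → odd n * (2 * suc t)) odd-expanding (2 * p + 1) t (1 + p)
    (λ r → 𝐃^ (2 * r ∸ 1) (lambertF ε δ (2 * p ∸ 2 * r + 2)))
    (λ r → 𝐃^ (2 * p + 1) (lambertC δ ε (2 * r ∸ 2 * p ∸ 2)))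
    (λ _ → refl) (s≤s z≤n)
    (λ r 1≤r r≤p → 𝐃^-lambertF ε δ (2 * p + 1) r (2 * p ∸ 2 * r + 2) (2p∸2r+2+[2r∸1] r p 1≤r (s≤s⁻¹ r≤p)))
    (λ r p<r → 𝐃^-lambertC-swap ε δ (2 * p + 1) r (2 * r ∸ 2 * p ∸ 2) (2r∸2p∸2+[2p+1] r p p<r))

  identityₒ-odd-odd : ∀ s p →
    fromℕ ((2 * s) !) · alternate δ s (powersₒ ε δ (2 * s + 1) (2 * p + 1))
    ≈ (∑[ 0 ≤ r < 1 + p ] tₒ s r · 𝐃^ (2 * r) (lambertH ε δ (2 * p ∸ 2 * r + 1)))
    ⊕ (∑[ 1 + p ≤ r < 1 + s ] 2^ (+ (2 * p + 1) - + (2 * r)) · tₒ s r · 𝐃^ (2 * p + 1) (lambertH δ ε (2 * r ∸ 2 * p ∸ 1)))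
  identityₒ-odd-odd s p = odd-identity ε δ odd odd (λ n → odd n * (2 * s + 1)) odd-expanding (2 * p + 1) s (1 + p)
    (λ r → tₒ s r · 𝐃^ (2 * r) (lambertH ε δ (2 * p ∸ 2 * r + 1)))
    (λ r → 2^ (+ (2 * p + 1) - + (2 * r)) · tₒ s r · 𝐃^ (2 * p + 1) (lambertH δ ε (2 * r ∸ 2 * p ∸ 1)))
    (λ _ → refl)
    (λ r r≤p → ·-congˡ (tₒ s r) (𝐃^-lambertH ε δ (2 * p + 1) r (2 * p ∸ 2 * r + 1) (2p∸2r+1+2r r p (s≤s⁻¹ r≤p))))
    (λ r p<r → 𝐃^-lambertH-swap ε δ (2 * p + 1) (tₒ s r) r (2 * r ∸ 2 * p ∸ 1) (2r∸2p∸1+[2p+1] r p p<r))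

  identityₒ-odd-even : ∀ s p →
    fromℕ ((2 * s) !) · alternate δ s (powersₒ ε δ (2 * s + 1) (2 * p))
    ≈ (∑[ 0 ≤ r < p ] tₒ s r · 𝐃^ (2 * r) (lambertH ε δ (2 * p ∸ 2 * r)))
    ⊕ (∑[ p ≤ r < 1 + s ] 2^ (+ (2 * p) - + (2 * r)) · tₒ s r · 𝐃^ (2 * p) (lambertH δ ε (2 * r ∸ 2 * p)))
  identityₒ-odd-even s p = odd-identity ε δ odd odd (λ n → odd n * (2 * s + 1)) odd-expanding (2 * p) s p
    (λ r → tₒ s r · 𝐃^ (2 * r) (lambertH ε δ (2 * p ∸ 2 * r)))
    (λ r → 2^ (+ (2 * p) - + (2 * r)) · tₒ s r · 𝐃^ (2 * p) (lambertH δ ε (2 * r ∸ 2 * p)))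
    (λ _ → refl)
    (λ r r<p → ·-congˡ (tₒ s r) (𝐃^-lambertH ε δ (2 * p) r (2 * p ∸ 2 * r) (2p∸2r+2r r p (ℕ.<⇒≤ r<p))))
    (λ r p≤r → 𝐃^-lambertH-swap ε δ (2 * p) (tₒ s r) r (2 * r ∸ 2 * p) (2p∸2r+2r p r p≤r))

theorem3p2 : (s p : ℕ) → 1 ≤ s →
    (fromℕ ((2 * s ∸ 1) !) · I (2 * s) (2 * p)
    ≈ (∑[ 1 ≤ r < 1 + p ] tₑ s r · (𝐃^ (2 * r ∸ 1) (A (2 * p ∸ 2 * r + 1))) ⟨q²⟩)
    ⊕ (∑[ 1 + p ≤ r < 1 + s ] tₑ s r · (𝐃^ (2 * p) (A (2 * r ∸ 2 * p ∸ 1))) ⟨q²⟩)) ×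
    (fromℕ ((2 * s) !) · I (2 * s + 1) (2 * p + 1)
    ≈ (∑[ 0 ≤ r < 1 + p ] 2^ (- (+ (2 * r))) · tₒ s r · 𝐃^ (2 * r) (C (2 * p ∸ 2 * r + 1)))
    ⊕ (∑[ 1 + p ≤ r < 1 + s ] 2^ (- (+ (2 * r))) · tₒ s r · 𝐃^ (2 * p + 1) (F (2 * r ∸ 2 * p ∸ 1)))) ×
    (fromℕ ((2 * s ∸ 1) !) · -1^ (s ∸ 1) · II (2 * s) (2 * p)
    ≈ (∑[ 1 ≤ r < 1 + p ] tₑ s r · (𝐃^ (2 * r ∸ 1) (L (2 * p ∸ 2 * r + 1))) ⟨q²⟩)
    ⊕ (∑[ 1 + p ≤ r < 1 + s ] tₑ s r · (𝐃^ (2 * p) (B (2 * r ∸ 2 * p ∸ 1))) ⟨q²⟩)) ×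
    (fromℕ ((2 * s) !) · -1^ s · II (2 * s + 1) (2 * p)
    ≈ (∑[ 0 ≤ r < p ] 2^ (- (+ (2 * r))) · tₒ s r · 𝐃^ (2 * r) (N (2 * p ∸ 2 * r)))
    ⊕ (∑[ p ≤ r < 1 + s ] 2^ (- (+ (2 * r))) · tₒ s r · 𝐃^ (2 * p) (G (2 * r ∸ 2 * p)))) ×
    (fromℕ ((2 * s ∸ 1) !) · III (2 * s) (2 * p)
    ≈ (∑[ 1 ≤ r < 1 + p ] tₑ s r · 𝐃^ (2 * r ∸ 1) (F (2 * p ∸ 2 * r + 1)))
    ⊕ (∑[ 1 + p ≤ r < 1 + s ] tₑ s r · 𝐃^ (2 * p) (C (2 * r ∸ 2 * p ∸ 1)))) ×
    (fromℕ ((2 * s) !) · III (2 * s + 1) (2 * p + 1)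
    ≈ (∑[ 0 ≤ r < 1 + p ] tₒ s r · 𝐃^ (2 * r) (H (2 * p ∸ 2 * r + 1)))
    ⊕ (∑[ 1 + p ≤ r < 1 + s ] 2^ (+ (2 * p + 1) - + (2 * r)) · tₒ s r · 𝐃^ (2 * p + 1) (H (2 * r ∸ 2 * p ∸ 1)))) ×
    (fromℕ ((2 * s ∸ 1) !) · -1^ (s ∸ 1) · IV (2 * s) (2 * p)
    ≈ (∑[ 1 ≤ r < 1 + p ] tₑ s r · 𝐃^ (2 * r ∸ 1) (Q (2 * p ∸ 2 * r + 1)))
    ⊕ (∑[ 1 + p ≤ r < 1 + s ] tₑ s r · 𝐃^ (2 * p) (D (2 * r ∸ 2 * p ∸ 1)))) ×
    (fromℕ ((2 * s) !) · -1^ s · IV (2 * s + 1) (2 * p)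
    ≈ (∑[ 0 ≤ r < p ] tₒ s r · 𝐃^ (2 * r) (T (2 * p ∸ 2 * r)))
    ⊕ (∑[ p ≤ r < 1 + s ] 2^ (+ (2 * p) - + (2 * r)) · tₒ s r · 𝐃^ (2 * p) (J (2 * r ∸ 2 * p)))) ×
    (fromℕ ((2 * s ∸ 1) !) · V (2 * s) (2 * p)
    ≈ (∑[ 1 ≤ r < 1 + p ] tₑ s r · (𝐃^ (2 * r ∸ 1) (B (2 * p ∸ 2 * r + 1))) ⟨q²⟩)
    ⊕ (∑[ 1 + p ≤ r < 1 + s ] tₑ s r · (𝐃^ (2 * p) (L (2 * r ∸ 2 * p ∸ 1))) ⟨q²⟩)) ×
    (fromℕ ((2 * s) !) · V (2 * s + 1) (2 * p + 1)
    ≈ (∑[ 0 ≤ r < 1 + p ] 2^ (- (+ (2 * r))) · tₒ s r · 𝐃^ (2 * r) (D (2 * p ∸ 2 * r + 1)))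
    ⊕ (∑[ 1 + p ≤ r < 1 + s ] 2^ (- (+ (2 * r))) · tₒ s r · 𝐃^ (2 * p + 1) (Q (2 * r ∸ 2 * p ∸ 1)))) ×
    (fromℕ ((2 * s ∸ 1) !) · -1^ (s ∸ 1) · VI (2 * s) (2 * p)
    ≈ (∑[ 1 ≤ r < 1 + p ] tₑ s r · (𝐃^ (2 * r ∸ 1) (M (2 * p ∸ 2 * r + 1))) ⟨q²⟩)
    ⊕ (∑[ 1 + p ≤ r < 1 + s ] tₑ s r · (𝐃^ (2 * p) (M (2 * r ∸ 2 * p ∸ 1))) ⟨q²⟩)) ×
    (fromℕ ((2 * s) !) · -1^ s · VI (2 * s + 1) (2 * p)
    ≈ (∑[ 0 ≤ r < p ] 2^ (- (+ (2 * r))) · tₒ s r · 𝐃^ (2 * r) (P (2 * p ∸ 2 * r)))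
    ⊕ (∑[ p ≤ r < 1 + s ] 2^ (- (+ (2 * r))) · tₒ s r · 𝐃^ (2 * p) (R (2 * r ∸ 2 * p)))) ×
    (fromℕ ((2 * s ∸ 1) !) · VII (2 * s) (2 * p + 1)
    ≈ (∑[ 1 ≤ r < 1 + p ] tₑ s r · 𝐃^ (2 * r ∸ 1) (G (2 * p ∸ 2 * r + 2)))
    ⊕ (∑[ 1 + p ≤ r < 1 + s ] tₑ s r · 𝐃^ (2 * p + 1) (N (2 * r ∸ 2 * p ∸ 2)))) ×
    (fromℕ ((2 * s) !) · VII (2 * s + 1) (2 * p)
    ≈ (∑[ 0 ≤ r < p ] tₒ s r · 𝐃^ (2 * r) (J (2 * p ∸ 2 * r)))
    ⊕ (∑[ p ≤ r < 1 + s ] 2^ (+ (2 * p) - + (2 * r)) · tₒ s r · 𝐃^ (2 * p) (T (2 * r ∸ 2 * p)))) ×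
    (fromℕ ((2 * s ∸ 1) !) · -1^ (s ∸ 1) · VIII (2 * s) (2 * p + 1)
    ≈ (∑[ 1 ≤ r < 1 + p ] tₑ s r · 𝐃^ (2 * r ∸ 1) (R (2 * p ∸ 2 * r + 2)))
    ⊕ (∑[ 1 + p ≤ r < 1 + s ] tₑ s r · 𝐃^ (2 * p + 1) (P (2 * r ∸ 2 * p ∸ 2)))) ×
    (fromℕ ((2 * s) !) · -1^ s · VIII (2 * s + 1) (2 * p + 1)
    ≈ (∑[ 0 ≤ r < 1 + p ] tₒ s r · 𝐃^ (2 * r) (U (2 * p ∸ 2 * r + 1)))
    ⊕ (∑[ 1 + p ≤ r < 1 + s ] 2^ (+ (2 * p + 1) - + (2 * r)) · tₒ s r · 𝐃^ (2 * p + 1) (U (2 * r ∸ 2 * p ∸ 1))))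
theorem3p2 s@(suc t) p _ =
  -- The first sign is `neg` for the alternating series `V` to `VIII`, the second for `II`, `IV`,
  -- `VI`, `VIII`, whose denominators have a plus. Even powers take t = s - 1, the exponent of their
  -- sign, and odd powers take s.
  identityₑ-even      pos pos t p ,
  identityₑ-odd-odd   pos pos s p ,
  identityₑ-even      pos neg t p ,
  identityₑ-odd-even  pos neg s p ,
  identityₒ-even-even pos pos t p ,
  identityₒ-odd-odd   pos pos s p ,
  identityₒ-even-even pos neg t p ,
  identityₒ-odd-even  pos neg s p ,
  identityₑ-even      neg pos t p ,
  identityₑ-odd-odd   neg pos s p ,
  identityₑ-even      neg neg t p ,
  identityₑ-odd-even  neg neg s p ,
  identityₒ-even-odd  neg pos t p ,
  identityₒ-odd-even  neg pos s p ,
  identityₒ-even-odd  neg neg t p ,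
  identityₒ-odd-odd   neg neg s p
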